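{- For every real constant $c>0$ and every positive integer $N_0$, there exist an integer $N\ge N_0$ and a bipartite graph $W$ with $N$ vertices in each part and exactly $N^{6/5}$ edges such that $W$ is $C_{10}$-free and every subgraph of $W$ with at least $c\,|E(W)|$ edges contains a copy of $C_8$.
   Context: $C_m$ denotes the cycle of length $m$; a graph is $F$-free if it contains no subgraph isomorphic to $F$. (In the paper, $W$ is the Wenger graph $W_5(q)$: for a prime power $q$, the bipartite point–line incidence graph between $\mathbb{F}_q^5$ and the set of all affine lines $\{v+t(1,a,a^2,a^3,a^4): t\in\mathbb{F}_q\}$, $v\in\mathbb{F}_q^5$, $a\in\mathbb{F}_q$, so $N=q^5$.) -}

module Defs where

open import Data.Fin.Base using (Fin; toℕ)
import Data.Fin.Base as Fin
import Data.Fin.Properties as Fin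
open import Data.Fin.Subset using (Subset; _∈_; _∩_; _∪_; ∣_∣; Empty; ⊤)
  renaming (_⊆_ to _⊆ˢ_)
open import Data.Fin.Subset.Properties using (∈⊤)
open import Data.Integer.Base using (+_)
open import Data.List.Base using (allFin; cartesianProduct; filter; length)
open import Data.Nat.Base as ℕ using (ℕ; suc; z≤n; s≤s; _%_; NonZero)
import Data.Nat.DivMod as ℕ
import Data.Nat.Properties as ℕ
open import Data.Product.Base using (Σ-syntax; ∃-syntax; _×_; _,_; proj₁)
open import Data.Rational.Base as ℚ using (ℚ; 0ℚ; 1ℚ; ½; _/_; 1/_)
import Data.Rational.Properties as ℚ
open import Data.Rational.Solver using (module +-*-Solver)
open import Data.Sum.Base using (_⊎_; inj₁; inj₂; swap)
open import Function.Bundles using (_⇔_; _⤖_; module Bijection)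
open import Level using (0ℓ)
open import Relation.Binary.Core using (Rel)
open import Relation.Binary.Definitions using (Decidable; Symmetric; Irreflexive)
open import Relation.Binary.PropositionalEquality
open import Relation.Nullary.Decidable
  using (Dec; True; toWitness; _×-dec_; _⊎-dec_)
open import Relation.Nullary.Negation using (¬_)

Eventually : (ℕ → Set) → Set
Eventually P = ∃[ K ] ∀ n → K ℕ.≤ n → P n

-- Distinct sequences may represent the same real number; _≡_ on this type is
-- not equality of reals.
record ℝ : Set where
  constructor mkℝ
  field
    seq    : ℕ → ℚ
    cauchy : ∀ ε → 0ℚ ℚ.< ε →
             ∃[ K ] ∀ m n → K ℕ.≤ m → K ℕ.≤ n → ℚ.∣ seq m ℚ.- seq n ∣ ℚ.< ε

open ℝ public

infix 4 _<ᴿ_ _≤ᴿ_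

_<ᴿ_ : Rel ℝ 0ℓ
x <ᴿ y = ∃[ ε ] 0ℚ ℚ.< ε × Eventually (λ n → seq x n ℚ.+ ε ℚ.≤ seq y n)

_≤ᴿ_ : Rel ℝ 0ℓ
x ≤ᴿ y = ∀ ε → 0ℚ ℚ.< ε → Eventually (λ n → seq x n ℚ.≤ seq y n ℚ.+ ε)

fromℚ : ℚ → ℝ
fromℚ q .seq _ = q
fromℚ q .cauchy ε 0<ε =
  0 , λ _ _ _ _ → subst (λ r → ℚ.∣ r ∣ ℚ.< ε) (sym (ℚ.+-inverseʳ q)) 0<ε

fromℕ : ℕ → ℝ
fromℕ n = fromℚ (+ n / 1)

private

  bounded : ∀ x → ∃[ B ] ℚ.Positive B × Eventually (λ n → ℚ.∣ seq x n ∣ ℚ.≤ B)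
  bounded x with cauchy x 1ℚ (ℚ.positive⁻¹ 1ℚ)
  ... | K , close =
    B , ℚ.positive (ℚ.<-≤-trans (ℚ.positive⁻¹ 1ℚ) 1≤B) , K , bound
    where
    xK = seq x K
    B  = 1ℚ ℚ.+ ℚ.∣ xK ∣

    1≤B : 1ℚ ℚ.≤ B
    1≤B = subst (ℚ._≤ B) (ℚ.+-identityʳ 1ℚ) (ℚ.+-monoʳ-≤ 1ℚ (ℚ.0≤∣p∣ xK))

    bound : ∀ n → K ℕ.≤ n → ℚ.∣ seq x n ∣ ℚ.≤ B
    bound n K≤n = begin
      ℚ.∣ seq x n ∣                      ≡⟨ cong ℚ.∣_∣ (split (seq x n) xK) ⟩
      ℚ.∣ (seq x n ℚ.- xK) ℚ.+ xK ∣      ≤⟨ ℚ.∣p+q∣≤∣p∣+∣q∣ (seq x n ℚ.- xK) xK ⟩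
      ℚ.∣ seq x n ℚ.- xK ∣ ℚ.+ ℚ.∣ xK ∣  ≤⟨ ℚ.+-monoˡ-≤ ℚ.∣ xK ∣ (ℚ.<⇒≤ (close n K K≤n ℕ.≤-refl)) ⟩
      B                                  ∎
      where
      open ℚ.≤-Reasoning
      split : ∀ a b → a ≡ (a ℚ.- b) ℚ.+ b
      split = solve 2 (λ a b → a := (a :- b) :+ b) refl
        where open +-*-Solver

  module _ (B δ : ℚ) (B>0 : ℚ.Positive B) (0<δ : 0ℚ ℚ.< δ) where

    private instance
      pos-B  = B>0
      nz-B   = ℚ.pos⇒nonZero B
      pos-B⁻¹ = ℚ.1/pos⇒pos B
      pos-δ  = ℚ.positive 0<δ

    δ/B : ℚ
    δ/B = δ ℚ.* 1/ B

    0<δ/B : 0ℚ ℚ.< δ/B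
    0<δ/B = subst (ℚ._< δ/B) (ℚ.*-zeroʳ δ)
                  (ℚ.*-monoʳ-<-pos δ (ℚ.positive⁻¹ (1/ B)))

    ∣ab∣<δ : ∀ a b → ℚ.∣ a ∣ ℚ.≤ B → ℚ.∣ b ∣ ℚ.< δ/B → ℚ.∣ a ℚ.* b ∣ ℚ.< δ
    ∣ab∣<δ a b a≤B b<δ/B = begin-strict
      ℚ.∣ a ℚ.* b ∣        ≡⟨ ℚ.∣p*q∣≡∣p∣*∣q∣ a b ⟩
      ℚ.∣ a ∣ ℚ.* ℚ.∣ b ∣  ≤⟨ ℚ.*-monoʳ-≤-nonNeg ℚ.∣ b ∣ {{ℚ.∣-∣-nonNeg b}} a≤B ⟩
      B ℚ.* ℚ.∣ b ∣        <⟨ ℚ.*-monoʳ-<-pos B b<δ/B ⟩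
      B ℚ.* (δ ℚ.* 1/ B)   ≡⟨ shuffle B δ (1/ B) ⟩
      δ ℚ.* (B ℚ.* 1/ B)   ≡⟨ cong (δ ℚ.*_) (ℚ.*-inverseʳ B) ⟩
      δ ℚ.* 1ℚ             ≡⟨ ℚ.*-identityʳ δ ⟩
      δ                    ∎
      where
      open ℚ.≤-Reasoning
      shuffle : ∀ p q r → p ℚ.* (q ℚ.* r) ≡ q ℚ.* (p ℚ.* r)
      shuffle = solve 3 (λ p q r → p :* (q :* r) := q :* (p :* r)) refl
        where open +-*-Solver

  halve : ∀ ε → 0ℚ ℚ.< ε → ∃[ δ ] 0ℚ ℚ.< δ × δ ℚ.+ δ ≡ ε
  halve ε 0<ε = ½ ℚ.* ε , subst (ℚ._< ½ ℚ.* ε) (ℚ.*-zeroʳ ½) (ℚ.*-monoʳ-<-pos ½ 0<ε) ,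
    trans (sym (ℚ.*-distribʳ-+ ε ½ ½)) (ℚ.*-identityˡ ε)

  product-close : ∀ B C δ (B>0 : ℚ.Positive B) (C>0 : ℚ.Positive C) (0<δ : 0ℚ ℚ.< δ) →
                  ∀ a b c d → ℚ.∣ a ∣ ℚ.≤ B → ℚ.∣ d ∣ ℚ.≤ C →
                  ℚ.∣ b ℚ.- d ∣ ℚ.< δ/B B δ B>0 0<δ →
                  ℚ.∣ a ℚ.- c ∣ ℚ.< δ/B C δ C>0 0<δ →
                  ℚ.∣ a ℚ.* b ℚ.- c ℚ.* d ∣ ℚ.< δ ℚ.+ δ
  product-close B C δ B>0 C>0 0<δ a b c d a≤B d≤C b-d a-c = begin-strict
    ℚ.∣ a ℚ.* b ℚ.- c ℚ.* d ∣                            ≡⟨ cong ℚ.∣_∣ (expand a b c d) ⟩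
    ℚ.∣ a ℚ.* (b ℚ.- d) ℚ.+ d ℚ.* (a ℚ.- c) ∣            ≤⟨ ℚ.∣p+q∣≤∣p∣+∣q∣ (a ℚ.* (b ℚ.- d)) (d ℚ.* (a ℚ.- c)) ⟩
    ℚ.∣ a ℚ.* (b ℚ.- d) ∣ ℚ.+ ℚ.∣ d ℚ.* (a ℚ.- c) ∣      <⟨ ℚ.+-mono-<
                                                               (∣ab∣<δ B δ B>0 0<δ a (b ℚ.- d) a≤B b-d)
                                                               (∣ab∣<δ C δ C>0 0<δ d (a ℚ.- c) d≤C a-c) ⟩
    δ ℚ.+ δ                                              ∎
    where
    open ℚ.≤-Reasoning
    expand : ∀ a b c d →
             a ℚ.* b ℚ.- c ℚ.* d ≡ a ℚ.* (b ℚ.- d) ℚ.+ d ℚ.* (a ℚ.- c)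
    expand = solve 4 (λ a b c d →
      a :* b :- c :* d := a :* (b :- d) :+ d :* (a :- c)) refl
      where open +-*-Solver

  *-cauchy : ∀ x y ε →
             ∃[ B ] ℚ.Positive B × Eventually (λ n → ℚ.∣ seq x n ∣ ℚ.≤ B) →
             ∃[ C ] ℚ.Positive C × Eventually (λ n → ℚ.∣ seq y n ∣ ℚ.≤ C) →
             ∃[ δ ] 0ℚ ℚ.< δ × δ ℚ.+ δ ≡ ε →
             ∃[ K ] ∀ m n → K ℕ.≤ m → K ℕ.≤ n →
             ℚ.∣ seq x m ℚ.* seq y m ℚ.- seq x n ℚ.* seq y n ∣ ℚ.< ε
  *-cauchy x y ε (B , B>0 , k₁ , x≤B) (C , C>0 , k₂ , y≤C) (δ , 0<δ , refl)
    with cauchy x (δ/B C δ C>0 0<δ) (0<δ/B C δ C>0 0<δ)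
       | cauchy y (δ/B B δ B>0 0<δ) (0<δ/B B δ B>0 0<δ)
  ... | k₃ , x-close | k₄ , y-close = k₁ ℕ.⊔ k₂ ℕ.⊔ (k₃ ℕ.⊔ k₄) , λ m n K≤m K≤n →
    product-close B C δ B>0 C>0 0<δ (seq x m) (seq y m) (seq x n) (seq y n)
      (x≤B m (ℕ.m⊔n≤o⇒m≤o k₁ k₂ (k₁₂ K≤m)))
      (y≤C n (ℕ.m⊔n≤o⇒n≤o k₁ k₂ (k₁₂ K≤n)))
      (y-close m n (ℕ.m⊔n≤o⇒n≤o k₃ k₄ (k₃₄ K≤m)) (ℕ.m⊔n≤o⇒n≤o k₃ k₄ (k₃₄ K≤n)))
      (x-close m n (ℕ.m⊔n≤o⇒m≤o k₃ k₄ (k₃₄ K≤m)) (ℕ.m⊔n≤o⇒m≤o k₃ k₄ (k₃₄ K≤n)))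
    where
    k₁₂ : ∀ {n} → k₁ ℕ.⊔ k₂ ℕ.⊔ (k₃ ℕ.⊔ k₄) ℕ.≤ n → k₁ ℕ.⊔ k₂ ℕ.≤ n
    k₁₂ = ℕ.m⊔n≤o⇒m≤o (k₁ ℕ.⊔ k₂) (k₃ ℕ.⊔ k₄)
    k₃₄ : ∀ {n} → k₁ ℕ.⊔ k₂ ℕ.⊔ (k₃ ℕ.⊔ k₄) ℕ.≤ n → k₃ ℕ.⊔ k₄ ℕ.≤ n
    k₃₄ = ℕ.m⊔n≤o⇒n≤o (k₁ ℕ.⊔ k₂) (k₃ ℕ.⊔ k₄)

infixl 7 _*ᴿ_

_*ᴿ_ : ℝ → ℝ → ℝ
(x *ᴿ y) .seq n        = seq x n ℚ.* seq y n
(x *ᴿ y) .cauchy ε 0<ε = *-cauchy x y ε (bounded x) (bounded y) (halve ε 0<ε)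

-- The vertex set is a subset of Fin n, so that a subgraph, which may omit
-- vertices, is again a graph over the same n.
record Graph (n : ℕ) : Set₁ where
  infix 4 _~_ _~?_
  field
    V        : Subset n
    _~_      : Rel (Fin n) 0ℓ
    _~?_     : Decidable _~_
    ~-sym    : Symmetric _~_
    ~-irrefl : Irreflexive _≡_ _~_
    ~⇒∈      : ∀ {i j} → i ~ j → i ∈ V

  Vertex : Set
  Vertex = ∃[ i ] i ∈ V

-- Each edge is counted once, as the pair of its endpoints in increasing order.
∣E_∣ : ∀ {n} → Graph n → ℕ
∣E_∣ {n} G = length (filter edge? (cartesianProduct (allFin n) (allFin n)))
  where
  open Graph G
  edge? : (p : Fin n × Fin n) → Dec (let (i , j) = p in i Fin.< j × i ~ j)
  edge? (i , j) = (i Fin.<? j) ×-dec (i ~? j)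

infix 4 _⊆_ _≅_

_⊆_ : ∀ {n} → Graph n → Graph n → Set
H ⊆ G = Graph.V H ⊆ˢ Graph.V G × (∀ {i j} → Graph._~_ H i j → Graph._~_ G i j)

record _≅_ {m n} (F : Graph m) (G : Graph n) : Set where
  private
    module F = Graph F
    module G = Graph G
  field
    vertices : F.Vertex ⤖ G.Vertex
  open Bijection vertices using (to)
  field
    edges : ∀ u v → proj₁ u F.~ proj₁ v ⇔ proj₁ (to u) G.~ proj₁ (to v)

-- G need not induce the copy of F: S may omit edges of G.
_Contains_ : ∀ {m n} → Graph n → Graph m → Set₁
_Contains_ {n = n} G F = Σ[ S ∈ Graph n ] S ⊆ G × F ≅ S

_-Free_ : ∀ {m n} → Graph m → Graph n → Set₁
F -Free G = ¬ (G Contains F)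

record BipartiteWithParts {n} (G : Graph n) (a b : ℕ) : Set where
  open Graph G
  field
    A B      : Subset n
    disjoint : Empty (A ∩ B)
    cover    : A ∪ B ≡ V
    ∣A∣≡a    : ∣ A ∣ ≡ a
    ∣B∣≡b    : ∣ B ∣ ≡ b
    crossing : ∀ {i j} → i ~ j → (i ∈ A × j ∈ B) ⊎ (i ∈ B × j ∈ A)

C : ∀ m {3≤m : True (3 ℕ.≤? m)} → Graph m
C m {3≤m} = record
  { V        = ⊤
  ; _~_      = λ i j → Next i j ⊎ Next j i
  ; _~?_     = λ i j → next? i j ⊎-dec next? j i
  ; ~-sym    = swap
  ; ~-irrefl = λ { {i} refl (inj₁ p) → irr i p ; {i} refl (inj₂ p) → irr i p }
  ; ~⇒∈      = λ _ → ∈⊤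
  }
  where
  instance
    m≢0 : NonZero m
    m≢0 = ℕ.>-nonZero (ℕ.≤-trans (s≤s z≤n) (toWitness 3≤m))

  Next : Rel (Fin m) 0ℓ
  Next i j = toℕ j ≡ suc (toℕ i) % m

  next? : Decidable Next
  next? i j = toℕ j ℕ.≟ suc (toℕ i) % m

  irr : ∀ i → ¬ Next i i
  irr i p with ℕ.m≤n⇒m<n∨m≡n (Fin.toℕ<n i)
  ... | inj₁ i+1<m = ℕ.1+n≢n (sym (trans p (ℕ.m<n⇒m%n≡m i+1<m)))
  ... | inj₂ i+1≡m = ℕ.<-irrefl 1≡m (ℕ.≤-trans (s≤s (s≤s z≤n)) (toWitness 3≤m))
    where
    i≡0 : toℕ i ≡ 0
    i≡0 = trans p (trans (cong (_% m) i+1≡m) (ℕ.n%n≡0 m))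

    1≡m : 1 ≡ m
    1≡m = trans (cong suc (sym i≡0)) i+1≡m

{-# OPTIONS --safe #-}
-- W is the Wenger graph W₅(p) for a large prime p. A C₁₀ would be a closed chain of
-- five lines, so non-zero multiples of five vectors (1, a, a², a³, a⁴) would sum to
-- zero. By Vandermonde no direction a occurs only once among the five lines, and as
-- consecutive directions differ, equality of directions would pair up the five lines.
--
-- For C₈, apply "a map to n values on a set of size s ≥ m n has at least (m - 1) s
-- ordered collisions" three times in a subgraph with c p⁶ edges (x , a): to the map to
-- x, giving pairs of edges (x , a), (x , b); then to the map to b and the line through x
-- in direction a, giving pairs of points x, y on such a line; then to the map to a, the
-- displacement from x to y, and the line through x in direction b. A collision of the
-- last kind is a parallelogram, all of whose sides are made of edges of the subgraph.
module Submission where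

open import Defs
open import Data.Empty using () renaming (⊥ to Absurd)
open import Data.Fin.Base as Fin
  using (Fin; zero; suc; toℕ; fromℕ<; finToFun; funToFin; splitAt; _↑ˡ_; _↑ʳ_; combine)
open import Data.Fin.Patterns
import Data.Fin.Properties as Fin
open import Data.Fin.Subset as Subset using (Subset; inside; outside; ⊤; ⊥) renaming (_∈_ to _∈ˢ_)
open import Data.Fin.Subset.Properties as Subset using (∈⊤; _∈?_)
open import Data.Integer.Base as ℤ using (ℤ; +[1+_]; -[1+_]; 0ℤ; 1ℤ)
open import Data.Integer.DivMod using (n%ℕd<d; a≡a%ℕn+[a/ℕn]*n; _%ℕ_; _/ℕ_)
import Data.Integer.Properties as ℤ
open import Data.List.Base
  using (List; []; _∷_; _++_; length; map; filter; cartesianProduct; allFin; lookup)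
open import Data.List.Membership.Propositional using (_∈_)
open import Data.List.Membership.Propositional.Properties
import Data.List.Properties as List
open import Data.List.Relation.Binary.Subset.Propositional using () renaming (_⊆_ to _⊆ᴸ_)
open import Data.List.Relation.Unary.All as All using (All; []; _∷_)
import Data.List.Relation.Unary.All.Properties as All
open import Data.List.Relation.Unary.AllPairs using ([]; _∷_)
open import Data.List.Relation.Unary.Any using (here; there; index)
open import Data.List.Relation.Unary.Any.Properties using (lookup-index)
open import Data.List.Relation.Unary.Unique.Propositional using (Unique)
import Data.List.Relation.Unary.Unique.Propositional.Properties as Unique
open import Data.Nat.Base as ℕ using (ℕ; zero; suc; NonZero; z≤n; s≤s; z<s; s≤s⁻¹)
open import Data.Nat.DivMod using (m%n<n; m/n*n≤m; m*n/n≡m; /-monoˡ-≤; m≡m%n+[m/n]*n)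
import Data.Nat.Divisibility as ℕ
open import Data.Nat.ListAction using (sum; product)
open import Data.Nat.Primality using (Prime; ¬prime[0]; ¬prime[1]; prime⇒nonZero; euclidsLemma)
open import Data.Nat.Primality.Factorisation using (module PrimeFactorisation; factorise)
import Data.Nat.Properties as ℕ
open import Data.Product.Base using (Σ-syntax; ∃-syntax; _×_; _,_; proj₁; proj₂)
import Data.Product.Properties as Product
import Data.Rational.Base as ℚ
import Data.Rational.Properties as ℚ
import Data.Rational.Unnormalised.Base as ℚᵘ
import Data.Rational.Unnormalised.Properties as ℚᵘ
open import Data.Sum.Base using (_⊎_; inj₁; inj₂; [_,_])
import Data.Vec.Base as Vec
import Data.Vec.Properties as Vec
open import Data.Vec.Properties.WithK using ([]=-irrelevant)
open import Function.Base using (_∘_; case_of_)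
open import Function.Bundles using (module Bijection; module Equivalence; mk⤖; mk⇔)
open import Relation.Binary.Definitions using (DecidableEquality)
open import Relation.Binary.PropositionalEquality
open import Relation.Nullary.Decidable using (Dec; yes; no; does; dec-true; ¬?; _×-dec_)
open import Relation.Nullary.Negation using (¬_; contradiction)
open import Relation.Unary using (Decidable)
open import Algebra.Properties.CommutativeMonoid.Sum ℕ.+-0-commutativeMonoid
  using (∑-distrib-+; sum-syntax; sum-cong-≗)

-- Affine lines with directions on the moment curve

module _ where
  open import Data.Integer.Base using (+_; _+_; _-_; _*_; _^_)
  open import Data.Integer.Divisibility.Signed
  open import Data.Integer.Solver using (module +-*-Solver)

  private module S = +-*-Solver

  funToFin-cong : ∀ {m n} {f g : Fin m → Fin n} → f ≗ g → funToFin f ≡ funToFin g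
  funToFin-cong {zero}  f≗g = refl
  funToFin-cong {suc m} f≗g rewrite f≗g zero | funToFin-cong (f≗g ∘ suc) = refl

  finToFun-injective : ∀ {m n} {i j : Fin (m ℕ.^ n)} → finToFun {m} {n} i ≗ finToFun j → i ≡ j
  finToFun-injective {m} {n} {i} {j} eq = trans (sym (Fin.funToFin-finToFin {n} {m} i))
    (trans (funToFin-cong eq) (Fin.funToFin-finToFin {n} {m} j))

  prime-∣* : ∀ {p} → Prime p → ∀ x y → + p ∣ x * y → + p ∣ x ⊎ + p ∣ y
  prime-∣* {p} pr x y p∣xy
    with euclidsLemma ℤ.∣ x ∣ ℤ.∣ y ∣ pr (subst (p ℕ.∣_) (ℤ.∣i*j∣≡∣i∣*∣j∣ x y) (∣⇒∣ᵤ p∣xy))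
  ... | inj₁ h = inj₁ (∣ᵤ⇒∣ h)
  ... | inj₂ h = inj₂ (∣ᵤ⇒∣ h)

  private
    distrib-twist : ∀ t a b e m m′ → t * (a - b) * e + (m′ - b * m) ≡
                    (t * (a * e) + m′) - b * (t * e + m)
    distrib-twist = S.solve 6 (λ t a b e m m′ →
      t S.:* (a S.:- b) S.:* e S.:+ (m′ S.:- b S.:* m) S.:=
      (t S.:* (a S.:* e) S.:+ m′) S.:- b S.:* (t S.:* e S.:+ m)) refl

  -- A list of pairs (t , a) stands for the measure with mass t at each a.
  moment : List (ℤ × ℤ) → ℕ → ℤ
  moment []            k = 0ℤ
  moment ((t , a) ∷ l) k = t * a ^ k + moment l k

  -- This is the measure multiplied by the function x - b, which kills any atom at b.
  twist : ℤ → List (ℤ × ℤ) → List (ℤ × ℤ)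
  twist b = map (λ (t , a) → t * (a - b) , a)

  moment-twist : ∀ b l k → moment (twist b l) k ≡ moment l (suc k) - b * moment l k
  moment-twist b []            k = sym (cong (0ℤ -_) (ℤ.*-zeroʳ b))
  moment-twist b ((t , a) ∷ l) k rewrite moment-twist b l k =
    distrib-twist t a b (a ^ k) (moment l k) (moment l (suc k))

  private
    -- The atom of mass s at b contributes s b^(k+1) - b s b^k = 0, hence its absence on the left.
    kill-head : ∀ t a e s b f m m′ →
      t * (a - b) * e + (m′ - b * m) ≡
      (t * (a * e) + (s * (b * f) + m′)) - b * (t * e + (s * f + m))
    kill-head = S.solve 8 (λ t a e s b f m m′ →
      t S.:* (a S.:- b) S.:* e S.:+ (m′ S.:- b S.:* m) S.:=
      (t S.:* (a S.:* e) S.:+ (s S.:* (b S.:* f) S.:+ m′))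
        S.:- b S.:* (t S.:* e S.:+ (s S.:* f S.:+ m))) refl

  -- Twisting by the second node removes it and lowers the number of known
  -- vanishing moments by one.
  vandermonde : ∀ {p} → Prime p → ∀ n t a l → length l ≡ n →
                (∀ k → k ℕ.≤ n → + p ∣ moment ((t , a) ∷ l) k) →
                All (λ (s , b) → ¬ + p ∣ a - b) l → + p ∣ t
  vandermonde {p} pr zero t a [] refl vanish [] =
    subst (+ p ∣_) (trans (ℤ.+-identityʳ (t * 1ℤ)) (ℤ.*-identityʳ t)) (vanish 0 z≤n)
  vandermonde {p} pr (suc n) t a ((s , b) ∷ l) eq vanish (a≉b ∷ a≉l) =
    case prime-∣* pr t (a - b) (vandermonde pr n (t * (a - b)) a (twist b l)
           (trans (List.length-map _ l) (ℕ.suc-injective eq)) vanish′ (All.map⁺ a≉l)) of λ where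
      (inj₁ p∣t)   → p∣t
      (inj₂ p∣a-b) → contradiction p∣a-b a≉b
    where
    vanish′ : ∀ k → k ℕ.≤ n → + p ∣ moment ((t * (a - b) , a) ∷ twist b l) k
    vanish′ k k≤n = subst (+ p ∣_) (sym eq′)
      (∣m∣n⇒∣m-n {m = moment ((t , a) ∷ (s , b) ∷ l) (suc k)} (vanish (suc k) (s≤s k≤n))
                 (∣n⇒∣m*n b (vanish k (ℕ.m≤n⇒m≤1+n k≤n))))
      where
      eq′ : moment ((t * (a - b) , a) ∷ twist b l) k ≡
            moment ((t , a) ∷ (s , b) ∷ l) (suc k) - b * moment ((t , a) ∷ (s , b) ∷ l) k
      eq′ = trans (cong (λ m → t * (a - b) * a ^ k + m) (moment-twist b l k))
              (kill-head t a (a ^ k) s b (b ^ k) (moment l k) (moment l (suc k)))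

  module _ {p : ℕ} .{{_ : NonZero p}} where

    residue : ℤ → Fin p
    residue z = fromℕ< (n%ℕd<d z p)

    rep : Fin p → ℤ
    rep a = + toℕ a

    rep-residue : ∀ z → + p ∣ z - rep (residue z)
    rep-residue z = divides (z /ℕ p) (begin
      z - rep (residue z)          ≡⟨ cong (λ r → z - + r) (Fin.toℕ-fromℕ< (n%ℕd<d z p)) ⟩
      z - + (z %ℕ p)               ≡⟨ cong (_- + (z %ℕ p)) (a≡a%ℕn+[a/ℕn]*n z p) ⟩
      (+ (z %ℕ p) + (z /ℕ p) * + p) - + (z %ℕ p)
        ≡⟨ S.solve 2 (λ r q → (r S.:+ q) S.:- r S.:= q) refl (+ (z %ℕ p)) ((z /ℕ p) * + p) ⟩
      (z /ℕ p) * + p               ∎)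
      where open ≡-Reasoning

    -- Two representatives in [0, p) differ by less than p, and 0 is the only multiple of p that
    -- small.
    rep-injective : ∀ a b → + p ∣ rep a - rep b → a ≡ b
    rep-injective a b p∣a-b =
      Fin.toℕ-injective (ℤ.+-injective (ℤ.i-j≡0⇒i≡j _ _ (ℤ.∣i∣≡0⇒i≡0 zero-abs)))
      where
      abs<p : ℤ.∣ rep a - rep b ∣ ℕ.< p
      abs<p = subst (λ z → ℤ.∣ z ∣ ℕ.< p) (sym (ℤ.m-n≡m⊖n (toℕ a) (toℕ b)))
        (ℕ.≤-<-trans (ℤ.∣m⊝n∣≤m⊔n (toℕ a) (toℕ b)) (ℕ.⊔-lub (Fin.toℕ<n a) (Fin.toℕ<n b)))
      zero-abs : ℤ.∣ rep a - rep b ∣ ≡ 0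
      zero-abs with ℤ.∣ rep a - rep b ∣ | abs<p | ∣⇒∣ᵤ p∣a-b
      ... | 0     | _   | _ = refl
      ... | suc n | n<p | h = contradiction h (ℕ.>⇒∤ n<p)

    residue-injective : ∀ x y → residue x ≡ residue y → + p ∣ x - y
    residue-injective x y eq = subst (+ p ∣_)
      (S.solve 3 (λ x y r → (x S.:- r) S.:- (y S.:- r) S.:= x S.:- y) refl x y (rep (residue y)))
      (∣m∣n⇒∣m-n (subst (λ r → + p ∣ x - rep r) eq (rep-residue x)) (rep-residue y))

    residue-cong : ∀ x y → + p ∣ x - y → residue x ≡ residue y
    residue-cong x y p∣x-y = rep-injective (residue x) (residue y) (subst (+ p ∣_)
      (S.solve 4 (λ x y r s → (x S.:- y) S.:- (x S.:- r) S.:+ (y S.:- s) S.:= r S.:- s) refl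
        x y (rep (residue x)) (rep (residue y)))
      (∣m∣n⇒∣m+n (∣m∣n⇒∣m-n p∣x-y (rep-residue x)) (rep-residue y)))

  -- Points and lines of 𝔽ₚ^(d+1) are both numbered by Fin (p ^ (d + 1)): the line
  -- through x in direction (1, a, …, a^d) has the coordinates a and
  -- x_k - a^k x_0 for 1 ≤ k ≤ d.
  module Wenger (p d : ℕ) (pr : Prime p) .{{_ : NonZero p}} where

    Point : Set
    Point = Fin (p ℕ.^ suc d)

    coord : Point → Fin (suc d) → ℤ
    coord x k = rep (finToFun {p} {suc d} x k)

    line-coords : Point → Fin p → Fin (suc d) → Fin p
    line-coords x a zero    = a
    line-coords x a (suc k) = residue (coord x (suc k) - rep a ^ suc (toℕ k) * coord x zero)

    line : Point → Fin p → Point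
    line x a = funToFin (line-coords x a)

    dir : Point → Fin p
    dir y = finToFun {p} {suc d} y zero

    dir-line : ∀ x a → dir (line x a) ≡ a
    dir-line x a = Fin.finToFun-funToFin (line-coords x a) zero

    step : Point → Point → Fin (suc d) → ℤ
    step x y k = coord y k - coord x k

    -- Equal residues of x_k - a^k x_0 and y_k - a^k y_0 make the step from x to y, modulo p, its
    -- zeroth coordinate times (1, a, ..., a^d).
    line-≡⇒ : ∀ {x y} a → line x a ≡ line y a →
              ∀ k → + p ∣ step x y k - step x y zero * rep a ^ toℕ k
    line-≡⇒ {x} {y} a eq zero =
      subst (+ p ∣_) (S.solve 1 (λ t → S.con 0ℤ S.:= t S.:- t S.:* S.con 1ℤ) refl (step x y zero))
        (divides 0ℤ refl)
    line-≡⇒ {x} {y} a eq (suc k) = subst (+ p ∣_)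
      (S.solve 5 (λ xk yk x₀ y₀ e → (yk S.:- e S.:* y₀) S.:- (xk S.:- e S.:* x₀) S.:=
                   (yk S.:- xk) S.:- (y₀ S.:- x₀) S.:* e) refl
         (coord x (suc k)) (coord y (suc k)) (coord x zero) (coord y zero) (rep a ^ suc (toℕ k)))
      (residue-injective (coord y (suc k) - rep a ^ suc (toℕ k) * coord y zero)
                         (coord x (suc k) - rep a ^ suc (toℕ k) * coord x zero) (begin
        line-coords y a (suc k)          ≡⟨ Fin.finToFun-funToFin (line-coords y a) (suc k) ⟨
        finToFun {p} (line y a) (suc k)  ≡⟨ cong (λ l → finToFun {p} {suc d} l (suc k)) eq ⟨
        finToFun {p} (line x a) (suc k)  ≡⟨ Fin.finToFun-funToFin (line-coords x a) (suc k) ⟩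
        line-coords x a (suc k)          ∎))
      where open ≡-Reasoning

    line-≡⇐ : ∀ {x y} a → (∀ k → + p ∣ step x y k - step x y zero * rep a ^ toℕ k) →
              line x a ≡ line y a
    line-≡⇐ {x} {y} a h = sym (funToFin-cong {f = line-coords y a} {g = line-coords x a} λ where
      zero    → refl
      (suc k) → residue-cong (coord y (suc k) - rep a ^ suc (toℕ k) * coord y zero)
                             (coord x (suc k) - rep a ^ suc (toℕ k) * coord x zero) (subst (+ p ∣_)
        (S.solve 5 (λ xk yk x₀ y₀ e → (yk S.:- xk) S.:- (y₀ S.:- x₀) S.:* e S.:=
                     (yk S.:- e S.:* y₀) S.:- (xk S.:- e S.:* x₀)) refl
          (coord x (suc k)) (coord y (suc k)) (coord x zero) (coord y zero) (rep a ^ suc (toℕ k)))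
        (h (suc k))))

    -- Along a line every coordinate of a step is a multiple of the zeroth one.
    point-≡ : ∀ {x y} a → line x a ≡ line y a → + p ∣ step x y zero → x ≡ y
    point-≡ {x} {y} a eq p∣t = finToFun-injective {p} {suc d} λ k →
      sym (rep-injective (finToFun {p} {suc d} y k) (finToFun {p} {suc d} x k)
        (∣m+n∣n⇒∣m (line-≡⇒ {x} {y} a eq k) (∣m⇒∣-m (∣m⇒∣m*n (rep a ^ toℕ k) p∣t))))

  -- The dimension is at least two here, so that coordinate 1 exists; along a line, its ratio to
  -- coordinate 0 is the direction itself.
  module Wenger⁺ (p d : ℕ) (pr : Prime p) .{{_ : NonZero p}} where
    open Wenger p (suc d) pr public

    private
      slope : ∀ {x y} a → line x a ≡ line y a →
              + p ∣ step x y (suc zero) - step x y zero * rep a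
      slope {x} {y} a eq = subst (λ e → + p ∣ step x y (suc zero) - step x y zero * e)
        (ℤ.^-identityʳ (rep a)) (line-≡⇒ {x} {y} a eq (suc zero))

    -- Coordinate 1 of the step is both t a and t b modulo p, where t is its zeroth coordinate. So p
    -- divides t (a - b), hence t.
    two-lines : ∀ {x y} a b → a ≢ b → line x a ≡ line y a → line x b ≡ line y b → x ≡ y
    two-lines {x} {y} a b a≢b eqa eqb =
      case prime-∣* pr (step x y zero) (rep a - rep b) (subst (+ p ∣_)
        (S.solve 4 (λ s t a b → (s S.:- t S.:* b) S.:- (s S.:- t S.:* a) S.:= t S.:* (a S.:- b))
          refl (step x y (suc zero)) (step x y zero) (rep a) (rep b))
        (∣m∣n⇒∣m-n (slope {x} {y} b eqb) (slope {x} {y} a eqa))) of λ where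
          (inj₁ h) → point-≡ {x} {y} a eqa h
          (inj₂ h) → contradiction (rep-injective a b h) a≢b

    -- On a line through x in direction a, this is the parameter t with y = x + t (1, a, a², ...).
    shift : Point → Point → Fin p
    shift x y = residue (step x y zero)

    shift-injective : ∀ {x y z} a → line x a ≡ line y a → line x a ≡ line z a →
                      shift x y ≡ shift x z → y ≡ z
    shift-injective {x} {y} {z} a xy xz eq = point-≡ {y} {z} a (trans (sym xy) xz) (subst (+ p ∣_)
      (S.solve 3 (λ x y z → (z S.:- x) S.:- (y S.:- x) S.:= z S.:- y) refl
        (coord x zero) (coord y zero) (coord z zero))
      (residue-injective (step x z zero) (step x y zero) (sym eq)))

    -- The displacements from x to x′ and from y to y′ are equal, being the same multiple of the
    -- same direction. So x′ and y′ differ as x and y do.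
    parallelogram : ∀ {x x′ y y′} a b → line x a ≡ line x′ a → line y a ≡ line y′ a →
                    shift x x′ ≡ shift y y′ → line x b ≡ line y b → line x′ b ≡ line y′ b
    parallelogram {x} {x′} {y} {y′} a b xx′ yy′ eq xy = line-≡⇐ {x′} {y′} b λ k →
      subst (+ p ∣_)
        (S.solve 10 (λ x x′ y y′ x₀ x₀′ y₀ y₀′ e f →
           -- Equal shifts agree only modulo p as integers; the summand with factor f - e accounts
           -- for their difference.
           ((y′ S.:- y) S.:- (y₀′ S.:- y₀) S.:* e) S.:- ((x′ S.:- x) S.:- (x₀′ S.:- x₀) S.:* e)
           S.:+ ((y S.:- x) S.:- (y₀ S.:- x₀) S.:* f)
           S.:+ (f S.:- e) S.:* ((x₀′ S.:- x₀) S.:- (y₀′ S.:- y₀))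
           S.:= (y′ S.:- x′) S.:- (y₀′ S.:- x₀′) S.:* f) refl
           (coord x k) (coord x′ k) (coord y k) (coord y′ k)
           (coord x zero) (coord x′ zero) (coord y zero) (coord y′ zero)
           (rep a ^ toℕ k) (rep b ^ toℕ k))
        (∣m∣n⇒∣m+n (∣m∣n⇒∣m+n (∣m∣n⇒∣m-n
            (line-≡⇒ {y} {y′} a yy′ k) (line-≡⇒ {x} {x′} a xx′ k))
            (line-≡⇒ {x} {y} b xy k))
          (∣n⇒∣m*n (rep b ^ toℕ k - rep a ^ toℕ k)
            (residue-injective (step x x′ zero) (step y y′ zero) eq)))

  -- Equality would match each of the five corners of a pentagon with exactly one
  -- other corner.
  pentagon-parity : ∀ {A : Set} {a₁ a₂ a₃ a₄ a₅ : A} →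
    a₁ ≢ a₂ → a₂ ≢ a₃ → a₃ ≢ a₄ → a₄ ≢ a₅ → a₅ ≢ a₁ →
    a₁ ≡ a₃ ⊎ a₁ ≡ a₄ → a₂ ≡ a₄ ⊎ a₂ ≡ a₅ → a₃ ≡ a₅ ⊎ a₃ ≡ a₁ →
    a₄ ≡ a₁ ⊎ a₄ ≡ a₂ → ¬ (a₅ ≡ a₂ ⊎ a₅ ≡ a₃)
  pentagon-parity f₁ f₂ f₃ f₄ f₅ (inj₁ refl) _ _ (inj₁ refl) _           = f₃ refl
  pentagon-parity f₁ f₂ f₃ f₄ f₅ (inj₁ refl) _ _ (inj₂ refl) (inj₁ refl) = f₄ refl
  pentagon-parity f₁ f₂ f₃ f₄ f₅ (inj₁ refl) _ _ (inj₂ refl) (inj₂ refl) = f₅ refl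
  pentagon-parity f₁ f₂ f₃ f₄ f₅ (inj₂ refl) (inj₁ refl) _ _ _           = f₁ refl
  pentagon-parity f₁ f₂ f₃ f₄ f₅ (inj₂ refl) (inj₂ refl) (inj₁ refl) _ _ = f₂ refl
  pentagon-parity f₁ f₂ f₃ f₄ f₅ (inj₂ refl) (inj₂ refl) (inj₂ refl) _ _ = f₃ refl

  module Wenger₅ (p : ℕ) (pr : Prime p) .{{_ : NonZero p}} where
    -- `Wenger⁺` raises 3 to 4, which gives five coordinates and so the moments 0 to 4.
    open Wenger⁺ p 3 pr public

    -- The steps around the pentagon sum to zero, so masses equal to the step parameters, placed at
    -- the five directions, have five vanishing moments. If a₁ occurred only once, its mass would
    -- vanish and x₁, x₂ would coincide.
    repeated-direction : ∀ x₁ x₂ x₃ x₄ x₅ a₁ a₂ a₃ a₄ a₅ →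
      line x₁ a₁ ≡ line x₂ a₁ → line x₂ a₂ ≡ line x₃ a₂ → line x₃ a₃ ≡ line x₄ a₃ →
      line x₄ a₄ ≡ line x₅ a₄ → line x₅ a₅ ≡ line x₁ a₅ →
      x₁ ≢ x₂ → a₁ ≢ a₂ → a₁ ≢ a₅ → a₁ ≡ a₃ ⊎ a₁ ≡ a₄
    repeated-direction x₁ x₂ x₃ x₄ x₅ a₁ a₂ a₃ a₄ a₅ e₁ e₂ e₃ e₄ e₅ x₁≢x₂ a₁≢a₂ a₁≢a₅ =
      case a₁ Fin.≟ a₃ of λ where
        (yes a₁≡a₃) → inj₁ a₁≡a₃
        (no a₁≢a₃)  → case a₁ Fin.≟ a₄ of λ where
          (yes a₁≡a₄) → inj₂ a₁≡a₄
          (no a₁≢a₄)  → contradiction (x₁≡x₂ a₁≢a₃ a₁≢a₄) x₁≢x₂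
      where
      t : Point → Point → ℤ
      t x y = step x y zero

      nodes : List (ℤ × ℤ)
      nodes = (t x₂ x₃ , rep a₂) ∷ (t x₃ x₄ , rep a₃) ∷ (t x₄ x₅ , rep a₄) ∷ (t x₅ x₁ , rep a₅) ∷ []

      -- Each bracket is a congruence supplied by `line-≡⇒`. The coordinate differences cancel
      -- around the pentagon and leave a moment.
      telescope : ∀ x₁ x₂ x₃ x₄ x₅ m₁ m₂ m₃ m₄ m₅ →
        0ℤ - (x₂ - x₁ - m₁) - (x₃ - x₂ - m₂) - (x₄ - x₃ - m₃) - (x₅ - x₄ - m₄) - (x₁ - x₅ - m₅)
        ≡ m₁ + (m₂ + (m₃ + (m₄ + (m₅ + 0ℤ))))
      telescope = S.solve 10 (λ x₁ x₂ x₃ x₄ x₅ m₁ m₂ m₃ m₄ m₅ →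
        S.con 0ℤ S.:- (x₂ S.:- x₁ S.:- m₁) S.:- (x₃ S.:- x₂ S.:- m₂) S.:- (x₄ S.:- x₃ S.:- m₃)
          S.:- (x₅ S.:- x₄ S.:- m₄) S.:- (x₁ S.:- x₅ S.:- m₅)
        S.:= m₁ S.:+ (m₂ S.:+ (m₃ S.:+ (m₄ S.:+ (m₅ S.:+ S.con 0ℤ))))) refl

      vanishᶠ : ∀ k → + p ∣ moment ((t x₁ x₂ , rep a₁) ∷ nodes) (toℕ k)
      vanishᶠ k = subst (+ p ∣_)
        (telescope (coord x₁ k) (coord x₂ k) (coord x₃ k) (coord x₄ k) (coord x₅ k)
          (t x₁ x₂ * rep a₁ ^ toℕ k) (t x₂ x₃ * rep a₂ ^ toℕ k) (t x₃ x₄ * rep a₃ ^ toℕ k)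
          (t x₄ x₅ * rep a₄ ^ toℕ k) (t x₅ x₁ * rep a₅ ^ toℕ k))
        (∣m∣n⇒∣m-n (∣m∣n⇒∣m-n (∣m∣n⇒∣m-n (∣m∣n⇒∣m-n (∣m∣n⇒∣m-n (divides 0ℤ refl)
          (line-≡⇒ {x₁} {x₂} a₁ e₁ k)) (line-≡⇒ {x₂} {x₃} a₂ e₂ k)) (line-≡⇒ {x₃} {x₄} a₃ e₃ k))
          (line-≡⇒ {x₄} {x₅} a₄ e₄ k)) (line-≡⇒ {x₅} {x₁} a₅ e₅ k))

      vanish : ∀ k → k ℕ.≤ 4 → + p ∣ moment ((t x₁ x₂ , rep a₁) ∷ nodes) k
      vanish k k≤4 = subst (λ k → + p ∣ moment ((t x₁ x₂ , rep a₁) ∷ nodes) k)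
        (Fin.toℕ-fromℕ< (s≤s k≤4)) (vanishᶠ (fromℕ< (s≤s k≤4)))

      x₁≡x₂ : a₁ ≢ a₃ → a₁ ≢ a₄ → x₁ ≡ x₂
      x₁≡x₂ a₁≢a₃ a₁≢a₄ = point-≡ {x₁} {x₂} a₁ e₁
        -- Only a₁ is separated from the other nodes; those four may coincide with one another.
        (vandermonde pr 4 (t x₁ x₂) (rep a₁) nodes refl vanish
          (a₁≢a₂ ∘ rep-injective a₁ a₂ ∷ a₁≢a₃ ∘ rep-injective a₁ a₃ ∷
           a₁≢a₄ ∘ rep-injective a₁ a₄ ∷ a₁≢a₅ ∘ rep-injective a₁ a₅ ∷ []))

    -- The hypotheses are invariant under rotation, so each side shares its direction with one of
    -- the two sides not adjacent to it.
    no-pentagon : ∀ x₁ x₂ x₃ x₄ x₅ a₁ a₂ a₃ a₄ a₅ →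
      line x₁ a₁ ≡ line x₂ a₁ → line x₂ a₂ ≡ line x₃ a₂ → line x₃ a₃ ≡ line x₄ a₃ →
      line x₄ a₄ ≡ line x₅ a₄ → line x₅ a₅ ≡ line x₁ a₅ →
      x₁ ≢ x₂ → x₂ ≢ x₃ → x₃ ≢ x₄ → x₄ ≢ x₅ → x₅ ≢ x₁ →
      a₁ ≢ a₂ → a₂ ≢ a₃ → a₃ ≢ a₄ → a₄ ≢ a₅ → ¬ a₅ ≢ a₁
    no-pentagon x₁ x₂ x₃ x₄ x₅ a₁ a₂ a₃ a₄ a₅ e₁ e₂ e₃ e₄ e₅ d₁ d₂ d₃ d₄ d₅ f₁ f₂ f₃ f₄ f₅ =
      pentagon-parity f₁ f₂ f₃ f₄ f₅
        (repeated-direction x₁ x₂ x₃ x₄ x₅ a₁ a₂ a₃ a₄ a₅ e₁ e₂ e₃ e₄ e₅ d₁ f₁ (f₅ ∘ sym))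
        (repeated-direction x₂ x₃ x₄ x₅ x₁ a₂ a₃ a₄ a₅ a₁ e₂ e₃ e₄ e₅ e₁ d₂ f₂ (f₁ ∘ sym))
        (repeated-direction x₃ x₄ x₅ x₁ x₂ a₃ a₄ a₅ a₁ a₂ e₃ e₄ e₅ e₁ e₂ d₃ f₃ (f₂ ∘ sym))
        (repeated-direction x₄ x₅ x₁ x₂ x₃ a₄ a₅ a₁ a₂ a₃ e₄ e₅ e₁ e₂ e₃ d₄ f₄ (f₃ ∘ sym))
        (repeated-direction x₅ x₁ x₂ x₃ x₄ a₅ a₁ a₂ a₃ a₄ e₅ e₁ e₂ e₃ e₄ d₅ f₅ (f₄ ∘ sym))

open import Data.Nat.Base using (_≤_; _<_; _+_; _*_; _^_; _%_; _/_; _⊔_; _!)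
open import Data.Nat.Solver using (module +-*-Solver)

-- Counting collisions

lookup-injective : ∀ {A : Set} {xs : List A} → Unique xs →
                   ∀ {i j} → lookup xs i ≡ lookup xs j → i ≡ j
lookup-injective (x∉ ∷ u) {zero}  {zero}  eq = refl
lookup-injective (x∉ ∷ u) {zero}  {suc j} eq = contradiction eq (All.lookup x∉ (∈-lookup j))
lookup-injective (x∉ ∷ u) {suc i} {zero}  eq = contradiction (sym eq) (All.lookup x∉ (∈-lookup i))
lookup-injective (x∉ ∷ u) {suc i} {suc j} eq = cong suc (lookup-injective u eq)

-- Sending an index of `xs` to an index of the same element in `ys` is injective.
unique-⊆⇒length-≤ : ∀ {A : Set} {xs ys : List A} → Unique xs → xs ⊆ᴸ ys → length xs ≤ length ys
unique-⊆⇒length-≤ {xs = xs} {ys} u xs⊆ys = Fin.injective⇒≤ {f = f} λ {i} {j} fi≡fj →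
  lookup-injective u (trans (lookup-index (xs⊆ys (∈-lookup i)))
    (trans (cong (lookup ys) fi≡fj) (sym (lookup-index (xs⊆ys (∈-lookup j))))))
  where
  f : Fin (length xs) → Fin (length ys)
  f i = index (xs⊆ys (∈-lookup i))

∑-mono : ∀ {n} {f g : Fin n → ℕ} → (∀ i → f i ≤ g i) → ∑[ i < n ] f i ≤ ∑[ i < n ] g i
∑-mono {zero}  f≤g = z≤n
∑-mono {suc n} f≤g = ℕ.+-mono-≤ (f≤g zero) (∑-mono (f≤g ∘ suc))

∑-const : ∀ n c → ∑[ i < n ] c ≡ n * c
∑-const zero    c = refl
∑-const (suc n) c = cong (c +_) (∑-const n c)

∑-*ˡ : ∀ {n} c (f : Fin n → ℕ) → ∑[ i < n ] (c * f i) ≡ c * ∑[ i < n ] f i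
∑-*ˡ {zero}  c f = sym (ℕ.*-zeroʳ c)
∑-*ˡ {suc n} c f = trans (cong (c * f zero +_) (∑-*ˡ c (f ∘ suc)))
                         (sym (ℕ.*-distribˡ-+ c (f zero) _))

module _ {A : Set} {n : ℕ} (f : A → Fin n) where

  fibre : Fin n → List A → List A
  fibre b = filter (λ s → f s Fin.≟ b)

  ∣fibre∣ : List A → Fin n → ℕ
  ∣fibre∣ l b = length (fibre b l)

private
  -- The functions `h` and `g′` differ only at `c`, and there by `g c`. The summand `g′ c` on both
  -- sides is cancelled in `∑-fibres`.
  ∑-point : ∀ {n} (c : Fin n) (h g g′ : Fin n → ℕ) → h c ≡ g c + g′ c →
            (∀ b → b ≢ c → h b ≡ g′ b) → ∑[ b < n ] h b + g′ c ≡ g c + g′ c + ∑[ b < n ] g′ b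
  ∑-point {suc n} zero h g g′ hc h≡ = begin
    h zero + _ + g′ zero
      ≡⟨ cong₂ (λ x y → x + y + g′ zero) hc (sum-cong-≗ (λ b → h≡ (suc b) λ ())) ⟩
    g zero + g′ zero + _ + g′ zero
      ≡⟨ solve 3 (λ a b c → a :+ b :+ c :+ b := a :+ b :+ (b :+ c)) refl (g zero) (g′ zero) _ ⟩
    g zero + g′ zero + (g′ zero + _) ∎
    where open ≡-Reasoning
          open +-*-Solver
  ∑-point {suc n} (suc c) h g g′ hc h≡ = begin
    h zero + S + g′ (suc c)   ≡⟨ ℕ.+-assoc (h zero) _ _ ⟩
    h zero + (S + g′ (suc c)) ≡⟨ cong₂ _+_ (h≡ zero λ ())
        (∑-point c (h ∘ suc) (g ∘ suc) (g′ ∘ suc) hc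
          λ b b≢c → h≡ (suc b) (b≢c ∘ Fin.suc-injective)) ⟩
    g′ zero + (g (suc c) + g′ (suc c) + S′)
      ≡⟨ solve 4 (λ z a b s → z :+ (a :+ b :+ s) := a :+ b :+ (z :+ s)) refl
           (g′ zero) (g (suc c)) (g′ (suc c)) S′ ⟩
    g (suc c) + g′ (suc c) + (g′ zero + S′) ∎
    where open ≡-Reasoning
          open +-*-Solver
          S = ∑[ b < n ] h (suc b)
          S′ = ∑[ b < n ] g′ (suc b)

-- Double counting: each x in `l` lies in exactly one fibre and contributes g (f x) there. Taking
-- fibre sizes for `g` gives the sum of their squares.
∑-fibres : ∀ {A : Set} {n} (f : A → Fin n) (g : Fin n → ℕ) l →
           ∑[ b < n ] (∣fibre∣ f l b * g b) ≡ sum (map (g ∘ f) l)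
∑-fibres {n = n} f g []      = trans (∑-const n 0) (ℕ.*-zeroʳ n)
∑-fibres {n = n} f g (x ∷ l) = ℕ.+-cancelʳ-≡ G′ _ _ (begin
  ∑[ b < n ] h b + G′             ≡⟨ ∑-point (f x) h g g′ at-fx off-fx ⟩
  g (f x) + G′ + ∑[ b < n ] g′ b ≡⟨ cong (g (f x) + G′ +_) (∑-fibres f g l) ⟩
  g (f x) + G′ + R                ≡⟨ solve 3 (λ a b c → a :+ b :+ c := a :+ c :+ b) refl (g (f x)) G′ R ⟩
  g (f x) + R + G′                ∎)
  where
  open ≡-Reasoning
  open +-*-Solver
  h g′ : Fin n → ℕ
  h  b = ∣fibre∣ f (x ∷ l) b * g b
  g′ b = ∣fibre∣ f l b * g b
  G′ = g′ (f x)
  R = sum (map (g ∘ f) l)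
  at-fx : h (f x) ≡ g (f x) + g′ (f x)
  at-fx = cong (λ l → length l * g (f x)) (List.filter-accept (λ s → f s Fin.≟ f x) refl)
  off-fx : ∀ b → b ≢ f x → h b ≡ g′ b
  off-fx b b≢ = cong (λ l → length l * g b) (List.filter-reject (λ s → f s Fin.≟ b) (b≢ ∘ sym))

sum-map-1 : ∀ {A : Set} (l : List A) → sum (map (λ _ → 1) l) ≡ length l
sum-map-1 []      = refl
sum-map-1 (_ ∷ l) = cong suc (sum-map-1 l)

private
  -- This is (s - m)² ≥ 0 without subtraction. Lowering both numbers by one keeps their difference,
  -- hence the simultaneous induction.
  tangent : ∀ m s → m * s + m * s ≤ s * s + m * m
  tangent zero    s       = z≤n
  tangent (suc m) zero    = ℕ.≤-trans (ℕ.≤-reflexive (cong₂ _+_ (ℕ.*-zeroʳ m) (ℕ.*-zeroʳ m))) z≤n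
  tangent (suc m) (suc s) = subst₂ _≤_
    (solve 2 (λ m s → con 2 :+ m :+ m :+ s :+ s :+ (m :* s :+ m :* s) :=
       (con 1 :+ m) :* (con 1 :+ s) :+ (con 1 :+ m) :* (con 1 :+ s)) refl m s)
    (solve 2 (λ m s → con 2 :+ m :+ m :+ s :+ s :+ (s :* s :+ m :* m) :=
       (con 1 :+ s) :* (con 1 :+ s) :+ (con 1 :+ m) :* (con 1 :+ m)) refl m s)
    (ℕ.+-monoʳ-≤ (2 + m + m + s + s) (tangent m s))
    where open +-*-Solver

-- Cauchy–Schwarz with the square replaced by its tangent s² ≥ 2ms − m².
sum-∣fibre∣-≥ : ∀ {A : Set} {n} (f : A → Fin n) m l → m * n ≤ length l →
                m * length l ≤ sum (map (∣fibre∣ f l ∘ f) l)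
sum-∣fibre∣-≥ {n = n} f m l mn≤ = ℕ.+-cancelʳ-≤ (m * length l) _ _ (begin
  m * length l + m * length l                 ≡⟨ cong (λ t → m * t + m * t) count ⟩
  m * ∑[ b < n ] c b + m * ∑[ b < n ] c b     ≡⟨ cong₂ _+_ (∑-*ˡ m c) (∑-*ˡ m c) ⟨
  ∑[ b < n ] (m * c b) + ∑[ b < n ] (m * c b) ≡⟨ ∑-distrib-+ (λ b → m * c b) (λ b → m * c b) ⟨
  ∑[ b < n ] (m * c b + m * c b)              ≤⟨ ∑-mono (λ b → tangent m (c b)) ⟩
  ∑[ b < n ] (c b * c b + m * m)              ≡⟨ ∑-distrib-+ (λ b → c b * c b) (λ _ → m * m) ⟩
  ∑[ b < n ] (c b * c b) + ∑[ b < n ] (m * m) ≡⟨ cong₂ _+_ (∑-fibres f c l) (∑-const n (m * m)) ⟩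
  sum (map (c ∘ f) l) + n * (m * m)           ≡⟨ cong (sum (map (c ∘ f) l) +_)
    (solve 2 (λ n m → n :* (m :* m) := m :* (m :* n)) refl n m) ⟩
  -- The error term m² n is at most one of the two copies of m times the length.
  sum (map (c ∘ f) l) + m * (m * n)           ≤⟨ ℕ.+-monoʳ-≤ (sum (map (c ∘ f) l))
    (ℕ.*-monoʳ-≤ m mn≤) ⟩
  sum (map (c ∘ f) l) + m * length l          ∎)
  where
  open ℕ.≤-Reasoning
  open +-*-Solver
  c = ∣fibre∣ f l
  count : length l ≡ ∑[ b < n ] c b
  count = trans (sym (sum-map-1 l)) (trans (sym (∑-fibres f (λ _ → 1) l))
    (sum-cong-≗ (λ b → ℕ.*-identityʳ (c b))))

length-cartesianProduct : ∀ {A B : Set} (xs : List A) (ys : List B) →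
                         length (cartesianProduct xs ys) ≡ length xs * length ys
length-cartesianProduct []       ys = refl
length-cartesianProduct (x ∷ xs) ys = trans (List.length-++ (map (x ,_) ys))
  (cong₂ _+_ (List.length-map (x ,_) ys) (length-cartesianProduct xs ys))

length-filter-cartesianProduct :
  ∀ {A B : Set} {P : A × B → Set} (P? : Decidable P) xs ys →
  length (filter P? (cartesianProduct xs ys)) ≡
  sum (map (λ x → length (filter (λ y → P? (x , y)) ys)) xs)
length-filter-cartesianProduct P? []       ys = refl
length-filter-cartesianProduct P? (x ∷ xs) ys = begin
  length (filter P? (map (x ,_) ys ++ cartesianProduct xs ys))
    ≡⟨ cong length (List.filter-++ P? (map (x ,_) ys) _) ⟩
  length (filter P? (map (x ,_) ys) ++ filter P? (cartesianProduct xs ys))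
    ≡⟨ List.length-++ (filter P? (map (x ,_) ys)) ⟩
  length (filter P? (map (x ,_) ys)) + length (filter P? (cartesianProduct xs ys))
    ≡⟨ cong₂ _+_ (row ys) (length-filter-cartesianProduct P? xs ys) ⟩
  _ ∎
  where
  open ≡-Reasoning
  row : ∀ ys → length (filter P? (map (x ,_) ys)) ≡ length (filter (λ y → P? (x , y)) ys)
  row [] = refl
  row (y ∷ ys) with P? (x , y)
  ... | yes _ = cong suc (row ys)
  ... | no _  = row ys

private
  sum-map-≤ : ∀ {A : Set} {g h : A → ℕ} → (∀ x → g x ≤ 1 + h x) →
              ∀ l → sum (map g l) ≤ length l + sum (map h l)
  sum-map-≤ g≤ []      = z≤n
  sum-map-≤ {g = g} {h} g≤ (x ∷ l) = ℕ.≤-trans (ℕ.+-mono-≤ (g≤ x) (sum-map-≤ g≤ l))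
    (ℕ.≤-reflexive (solve 3 (λ a b c → con 1 :+ a :+ (b :+ c) := con 1 :+ b :+ (a :+ c)) refl
      (h x) (length l) (sum (map h l))))
    where open +-*-Solver

module Collisions {A : Set} (_≟_ : DecidableEquality A) {n : ℕ} (f : A → Fin n) where

  Collide : A × A → Set
  Collide (s , t) = f t ≡ f s × s ≢ t

  collide? : Decidable Collide
  collide? (s , t) = (f t Fin.≟ f s) ×-dec ¬? (s ≟ t)

  collisions : List A → List (A × A)
  collisions l = filter collide? (cartesianProduct l l)

  collisions-unique : ∀ {l} → Unique l → Unique (collisions l)
  collisions-unique u = Unique.filter⁺ collide? (Unique.cartesianProduct⁺ u u)

  ∈-collisions⁻ : ∀ {l s t} → (s , t) ∈ collisions l → s ∈ l × t ∈ l × f t ≡ f s × s ≢ t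
  ∈-collisions⁻ {l} st∈ =
    let st∈l×l , ft≡fs , s≢t = ∈-filter⁻ collide? {xs = cartesianProduct l l} st∈
        s∈l , t∈l = ∈-cartesianProduct⁻ l l st∈l×l
    in s∈l , t∈l , ft≡fs , s≢t

  -- The fibre sizes, summed over the elements of `l`, count ordered pairs with equal values.
  -- Discarding the diagonal costs the length of `l` and lowers the factor from `suc m` to `m`.
  ∣collisions∣-≥ : ∀ m {l} → Unique l → suc m * n ≤ length l →
                   m * length l ≤ length (collisions l)
  ∣collisions∣-≥ m {l} u mn≤ = ℕ.+-cancelˡ-≤ (length l) _ _ (begin
    length l + m * length l             ≤⟨ sum-∣fibre∣-≥ f (suc m) l mn≤ ⟩
    sum (map (∣fibre∣ f l ∘ f) l)       ≤⟨ sum-map-≤ fibre-≤ l ⟩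
    length l + sum (map (λ s → length (filter (λ t → collide? (s , t)) l)) l)
      ≡⟨ cong (length l +_) (length-filter-cartesianProduct collide? l l) ⟨
    length l + length (collisions l)    ∎)
    where
    open ℕ.≤-Reasoning
    fibre-≤ : ∀ s → ∣fibre∣ f l (f s) ≤ 1 + length (filter (λ t → collide? (s , t)) l)
    fibre-≤ s = unique-⊆⇒length-≤ (Unique.filter⁺ (λ t → f t Fin.≟ f s) u) λ {t} t∈ →
      let t∈l , ft≡fs = ∈-filter⁻ (λ t → f t Fin.≟ f s) {xs = l} t∈ in
      case s ≟ t of λ where
        (yes refl) → here refl
        (no s≢t)   → there (∈-filter⁺ (λ t → collide? (s , t)) t∈l (ft≡fs , s≢t))

-- Copies of a graph in another

module _ {n : ℕ} {P : Fin n → Set} (P? : Decidable P) where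

  comprehension : Subset n
  comprehension = Vec.tabulate (does ∘ P?)

  ∈-comprehension⁺ : ∀ {i} → P i → i ∈ˢ comprehension
  ∈-comprehension⁺ {i} pi = Vec.lookup⇒[]= i comprehension
    (trans (Vec.lookup∘tabulate (does ∘ P?) i) (dec-true (P? i) pi))

  ∈-comprehension⁻ : ∀ {i} → i ∈ˢ comprehension → P i
  ∈-comprehension⁻ {i} i∈ with P? i | trans (sym (Vec.lookup∘tabulate (does ∘ P?) i)) (Vec.[]=⇒lookup i∈)
  ... | yes pi | _ = pi
  ... | no _   | ()

vertex-≡ : ∀ {n} {V : Subset n} {u v : ∃[ i ] i ∈ˢ V} → proj₁ u ≡ proj₁ v → u ≡ v
vertex-≡ {u = i , i∈} {v = _ , i∈′} refl = cong (i ,_) ([]=-irrelevant i∈ i∈′)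

module _ {m n : ℕ} {F : Graph m} {G : Graph n} where
  private
    module F = Graph F
    module G = Graph G

  -- The copy is the image of `f` with the images of the edges of `F` only, as `G` may have further
  -- edges between these vertices.
  injection⇒Contains : (f : Fin m → Fin n) → (∀ {i j} → f i ≡ f j → i ≡ j) →
                       (∀ {i} → i ∈ˢ F.V → f i ∈ˢ G.V) → (∀ {i j} → i F.~ j → f i G.~ f j) →
                       G Contains F
  injection⇒Contains f f-inj f-V f-~ =
    S , (S⊆G , λ { (k , l , refl , refl , k~l) → f-~ k~l }) , record
    { vertices = mk⤖ {to = λ (k , k∈) → f k , ∈-comprehension⁺ image? (k , k∈ , refl)}
        ( (λ eq → vertex-≡ (f-inj (cong proj₁ eq)))
        , λ (i , i∈) → let k , k∈ , fk≡i = ∈-comprehension⁻ image? i∈ in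
            (k , k∈) , λ { refl → vertex-≡ fk≡i })
    ; edges = λ (k , _) (l , _) → mk⇔ (λ k~l → k , l , refl , refl , k~l)
        λ (k′ , l′ , fk′≡fk , fl′≡fl , k′~l′) →
          subst₂ F._~_ (f-inj fk′≡fk) (f-inj fl′≡fl) k′~l′
    }
    where
    image? : Decidable (λ i → ∃[ k ] k ∈ˢ F.V × f k ≡ i)
    image? i = Fin.any? λ k → (k ∈? F.V) ×-dec (f k Fin.≟ i)

    S : Graph n
    S = record
      { V        = comprehension image?
      ; _~_      = λ i j → ∃[ k ] ∃[ l ] f k ≡ i × f l ≡ j × k F.~ l
      ; _~?_     = λ i j → Fin.any? λ k → Fin.any? λ l →
                     (f k Fin.≟ i) ×-dec (f l Fin.≟ j) ×-dec (k F.~? l)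
      ; ~-sym    = λ (k , l , p , q , k~l) → l , k , q , p , F.~-sym k~l
      ; ~-irrefl = λ { refl (k , l , p , q , k~l) → F.~-irrefl (f-inj (trans p (sym q))) k~l }
      ; ~⇒∈      = λ { (k , l , refl , _ , k~l) → ∈-comprehension⁺ image? (k , F.~⇒∈ k~l , refl) }
      }

    S⊆G : ∀ {i} → i ∈ˢ comprehension image? → i ∈ˢ G.V
    S⊆G i∈ with ∈-comprehension⁻ image? i∈
    ... | k , k∈ , refl = f-V k∈

  Contains⇒injection : G Contains F → (∀ i → i ∈ˢ F.V) →
    Σ[ f ∈ (Fin m → Fin n) ] (∀ {i j} → f i ≡ f j → i ≡ j) × (∀ {i j} → i F.~ j → f i G.~ f j)
  Contains⇒injection (S , (_ , ~S⇒~G) , F≅S) ∈V =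
    (λ i → proj₁ (to (i , ∈V i)))
    , (λ eq → cong proj₁ (injective (vertex-≡ eq)))
    , λ {i} {j} i~j → ~S⇒~G (Equivalence.to (edges (i , ∈V i) (j , ∈V j)) i~j)
    where
    open _≅_ F≅S
    open Bijection vertices using (to; injective)

octagon⇒Contains : ∀ {n} (H : Graph n) (let open Graph H) {u₀ u₁ u₂ u₃ u₄ u₅ u₆ u₇ : Fin n} →
  Unique (u₀ ∷ u₁ ∷ u₂ ∷ u₃ ∷ u₄ ∷ u₅ ∷ u₆ ∷ u₇ ∷ []) →
  u₀ ~ u₁ → u₁ ~ u₂ → u₂ ~ u₃ → u₃ ~ u₄ → u₄ ~ u₅ → u₅ ~ u₆ → u₆ ~ u₇ → u₇ ~ u₀ →
  H Contains C 8
octagon⇒Contains {n} H {u₀} {u₁} {u₂} {u₃} {u₄} {u₅} {u₆} {u₇} unique e₀ e₁ e₂ e₃ e₄ e₅ e₆ e₇ =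
  -- Every vertex of the octagon starts an edge, which places it in the vertex set of `H`.
  injection⇒Contains {F = C 8} {G = H} f (lookup-injective unique) (λ {i} _ → ~⇒∈ (succ i))
    λ {i} {j} → λ { (inj₁ p) → adj i j p ; (inj₂ p) → ~-sym (adj j i p) }
  where
  open Graph H
  f : Fin 8 → Fin n
  f = lookup (u₀ ∷ u₁ ∷ u₂ ∷ u₃ ∷ u₄ ∷ u₅ ∷ u₆ ∷ u₇ ∷ [])

  next : Fin 8 → Fin 8
  next i = Fin.fromℕ< {suc (toℕ i) % 8} {8} (m%n<n (suc (toℕ i)) 8)

  succ : ∀ i → f i ~ f (next i)
  succ 0F = e₀
  succ 1F = e₁
  succ 2F = e₂
  succ 3F = e₃
  succ 4F = e₄
  succ 5F = e₅
  succ 6F = e₆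
  succ 7F = e₇

  adj : ∀ i j → toℕ j ≡ suc (toℕ i) % 8 → f i ~ f j
  adj i j eq = subst (λ j → f i ~ f j)
    (sym (Fin.toℕ-injective (trans eq (sym (Fin.toℕ-fromℕ< (m%n<n (suc (toℕ i)) 8)))))) (succ i)

Contains⇒decagon : ∀ {n} {G : Graph n} (let open Graph G) → G Contains C 10 →
  Σ[ f ∈ (Fin 10 → Fin n) ] (∀ {i j} → f i ≡ f j → i ≡ j) ×
    (∀ i j → toℕ j ≡ suc (toℕ i) % 10 → f i ~ f j)
Contains⇒decagon {G = G} G⊇C =
  let f , f-inj , f-~ = Contains⇒injection {F = C 10} {G = G} G⊇C (λ _ → ∈⊤)
  in f , f-inj , λ i j eq → f-~ (inj₁ eq)

-- The incidence graph of points and lines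

-- Points and lines are both numbered by Fin M. Among the points of a line, y is
-- determined by x and shift x y.
record Geometry (M q : ℕ) : Set where
  field
    line  : Fin M → Fin q → Fin M
    dir   : Fin M → Fin q
    shift : Fin M → Fin M → Fin q
    dir-line  : ∀ x a → dir (line x a) ≡ a
    two-lines : ∀ {x y} a b → a ≢ b → line x a ≡ line y a → line x b ≡ line y b → x ≡ y
    no-pentagon : ∀ x₁ x₂ x₃ x₄ x₅ a₁ a₂ a₃ a₄ a₅ →
      line x₁ a₁ ≡ line x₂ a₁ → line x₂ a₂ ≡ line x₃ a₂ → line x₃ a₃ ≡ line x₄ a₃ →
      line x₄ a₄ ≡ line x₅ a₄ → line x₅ a₅ ≡ line x₁ a₅ →
      x₁ ≢ x₂ → x₂ ≢ x₃ → x₃ ≢ x₄ → x₄ ≢ x₅ → x₅ ≢ x₁ →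
      a₁ ≢ a₂ → a₂ ≢ a₃ → a₃ ≢ a₄ → a₄ ≢ a₅ → ¬ a₅ ≢ a₁
    shift-injective : ∀ {x y z} a → line x a ≡ line y a → line x a ≡ line z a →
                      shift x y ≡ shift x z → y ≡ z
    parallelogram : ∀ {x x′ y y′} a b → line x a ≡ line x′ a → line y a ≡ line y′ a →
                    shift x x′ ≡ shift y y′ → line x b ≡ line y b → line x′ b ≡ line y′ b

  line-dir : ∀ {x y a b} → line x a ≡ line y b → a ≡ b
  line-dir {x} {y} {a} {b} eq = trans (sym (dir-line x a)) (trans (cong dir eq) (dir-line y b))

module _ {m n : ℕ} (p : Subset m) (q : Subset n) where

  ∈-++ˡ⁺ : ∀ {i} → i ∈ˢ p → i ↑ˡ n ∈ˢ p Vec.++ q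
  ∈-++ˡ⁺ {i} i∈p = Vec.lookup⇒[]= _ (p Vec.++ q)
    (trans (Vec.lookup-++ˡ p q i) (Vec.[]=⇒lookup i∈p))

  ∈-++ˡ⁻ : ∀ {i} → i ↑ˡ n ∈ˢ p Vec.++ q → i ∈ˢ p
  ∈-++ˡ⁻ {i} i∈ = Vec.lookup⇒[]= i p (trans (sym (Vec.lookup-++ˡ p q i)) (Vec.[]=⇒lookup i∈))

  ∈-++ʳ⁺ : ∀ {i} → i ∈ˢ q → m ↑ʳ i ∈ˢ p Vec.++ q
  ∈-++ʳ⁺ {i} i∈q = Vec.lookup⇒[]= _ (p Vec.++ q)
    (trans (Vec.lookup-++ʳ p q i) (Vec.[]=⇒lookup i∈q))

  ∈-++ʳ⁻ : ∀ {i} → m ↑ʳ i ∈ˢ p Vec.++ q → i ∈ˢ q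
  ∈-++ʳ⁻ {i} i∈ = Vec.lookup⇒[]= i q (trans (sym (Vec.lookup-++ʳ p q i)) (Vec.[]=⇒lookup i∈))

∣p++q∣≡∣p∣+∣q∣ : ∀ {m n} (p : Subset m) (q : Subset n) →
                Subset.∣ p Vec.++ q ∣ ≡ Subset.∣ p ∣ + Subset.∣ q ∣
∣p++q∣≡∣p∣+∣q∣ Vec.[]            q = refl
∣p++q∣≡∣p∣+∣q∣ (inside Vec.∷ p)  q = cong suc (∣p++q∣≡∣p∣+∣q∣ p q)
∣p++q∣≡∣p∣+∣q∣ (outside Vec.∷ p) q = ∣p++q∣≡∣p∣+∣q∣ p q

module IncidenceGraph {M q : ℕ} (geometry : Geometry M q) where
  open Geometry geometry

  pt ln : Fin M → Fin (M + M)
  pt x = x ↑ˡ M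
  ln y = M ↑ʳ y

  pt-injective : ∀ {x x′} → pt x ≡ pt x′ → x ≡ x′
  pt-injective = Fin.↑ˡ-injective M _ _

  ln-injective : ∀ {y y′} → ln y ≡ ln y′ → y ≡ y′
  ln-injective = Fin.↑ʳ-injective M _ _

  pt<ln : ∀ x y → pt x Fin.< ln y
  pt<ln x y = subst₂ _<_ (sym (Fin.toℕ-↑ˡ x M)) (sym (Fin.toℕ-↑ʳ M y))
    (ℕ.<-≤-trans (Fin.toℕ<n x) (ℕ.m≤m+n M (toℕ y)))

  pt≢ln : ∀ {x y} → pt x ≢ ln y
  pt≢ln {x} {y} = Fin.<⇒≢ (pt<ln x y)

  -- A point lies on y when the parallel to y through that point is y itself.
  Incident : Fin M ⊎ Fin M → Fin M ⊎ Fin M → Set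
  Incident (inj₁ x) (inj₂ y) = line x (dir y) ≡ y
  Incident (inj₂ y) (inj₁ x) = line x (dir y) ≡ y
  Incident (inj₁ _) (inj₁ _) = Absurd
  Incident (inj₂ _) (inj₂ _) = Absurd

  incident? : ∀ u v → Dec (Incident u v)
  incident? (inj₁ x) (inj₂ y) = line x (dir y) Fin.≟ y
  incident? (inj₂ y) (inj₁ x) = line x (dir y) Fin.≟ y
  incident? (inj₁ _) (inj₁ _) = no λ ()
  incident? (inj₂ _) (inj₂ _) = no λ ()

  incident-sym : ∀ u v → Incident u v → Incident v u
  incident-sym (inj₁ _) (inj₂ _) x∈y = x∈y
  incident-sym (inj₂ _) (inj₁ _) x∈y = x∈y

  incident-irrefl : ∀ u → ¬ Incident u u
  incident-irrefl (inj₁ _) ()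
  incident-irrefl (inj₂ _) ()

  W : Graph (M + M)
  W = record
    { V        = ⊤
    ; _~_      = λ i j → Incident (splitAt M i) (splitAt M j)
    ; _~?_     = λ i j → incident? (splitAt M i) (splitAt M j)
    ; ~-sym    = λ {i} {j} → incident-sym (splitAt M i) (splitAt M j)
    ; ~-irrefl = λ { {i} refl → incident-irrefl (splitAt M i) }
    ; ~⇒∈      = λ _ → ∈⊤
    }

  open Graph W using (_~_)

  pt~ln : ∀ x a → pt x ~ ln (line x a)
  pt~ln x a = subst₂ Incident (sym (Fin.splitAt-↑ˡ M x M)) (sym (Fin.splitAt-↑ʳ M M (line x a)))
    (cong (line x) (dir-line x a))

  -- A view of adjacency that trades the number of a line for a point on it and its direction.
  data Edge : Fin (M + M) → Fin (M + M) → Set where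
    pt-ln : ∀ x a → Edge (pt x) (ln (line x a))
    ln-pt : ∀ x a → Edge (ln (line x a)) (pt x)

  private
    incident⇒edge : ∀ u v → Incident u v → Edge (Fin.join M M u) (Fin.join M M v)
    incident⇒edge (inj₁ x) (inj₂ y) x∈y = subst (λ y → Edge (pt x) (ln y)) x∈y (pt-ln x (dir y))
    incident⇒edge (inj₂ y) (inj₁ x) x∈y = subst (λ y → Edge (ln y) (pt x)) x∈y (ln-pt x (dir y))

  ~⇒edge : ∀ {i j} → i ~ j → Edge i j
  ~⇒edge {i} {j} i~j = subst₂ Edge (Fin.join-splitAt M M i) (Fin.join-splitAt M M j)
    (incident⇒edge (splitAt M i) (splitAt M j) i~j)

  data Vertexᵂ : Fin (M + M) → Set where
    isPt : ∀ x → Vertexᵂ (pt x)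
    isLn : ∀ y → Vertexᵂ (ln y)

  vertexᵂ : ∀ i → Vertexᵂ i
  vertexᵂ i = subst Vertexᵂ (Fin.join-splitAt M M i)
    ([_,_] {C = Vertexᵂ ∘ Fin.join M M} isPt isLn (splitAt M i))

  bipartite : BipartiteWithParts W M M
  bipartite = record
    { A        = A
    ; B        = B
    ; disjoint = λ (i , i∈A∩B) →
        let i∈A , i∈B = Subset.x∈p∩q⁻ A B i∈A∩B in A∩B≡∅ (vertexᵂ i) i∈A i∈B
    ; cover    = Subset.⊆-antisym Subset.⊆⊤ λ {i} _ → Subset.x∈p∪q⁺ (A∪B≡⊤ (vertexᵂ i))
    ; ∣A∣≡a    = trans (∣p++q∣≡∣p∣+∣q∣ (⊤ {M}) (⊥ {M}))
        (trans (cong₂ _+_ (Subset.∣⊤∣≡n M) (Subset.∣⊥∣≡0 M)) (ℕ.+-identityʳ M))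
    ; ∣B∣≡b    = trans (∣p++q∣≡∣p∣+∣q∣ (⊥ {M}) (⊤ {M}))
        (cong₂ _+_ (Subset.∣⊥∣≡0 M) (Subset.∣⊤∣≡n M))
    ; crossing = λ i~j → crossing (~⇒edge i~j)
    }
    where
    A B : Subset (M + M)
    A = ⊤ {M} Vec.++ ⊥ {M}
    B = ⊥ {M} Vec.++ ⊤ {M}

    A∩B≡∅ : ∀ {i} → Vertexᵂ i → i ∈ˢ A → ¬ i ∈ˢ B
    A∩B≡∅ (isPt x) _   x∈B = Subset.∉⊥ (∈-++ˡ⁻ (⊥ {M}) (⊤ {M}) x∈B)
    A∩B≡∅ (isLn y) y∈A _   = Subset.∉⊥ (∈-++ʳ⁻ (⊤ {M}) (⊥ {M}) y∈A)

    A∪B≡⊤ : ∀ {i} → Vertexᵂ i → i ∈ˢ A ⊎ i ∈ˢ B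
    A∪B≡⊤ (isPt x) = inj₁ (∈-++ˡ⁺ (⊤ {M}) (⊥ {M}) ∈⊤)
    A∪B≡⊤ (isLn y) = inj₂ (∈-++ʳ⁺ (⊥ {M}) (⊤ {M}) ∈⊤)

    crossing : ∀ {i j} → Edge i j → (i ∈ˢ A × j ∈ˢ B) ⊎ (i ∈ˢ B × j ∈ˢ A)
    crossing (pt-ln x a) = inj₁ (∈-++ˡ⁺ (⊤ {M}) (⊥ {M}) ∈⊤ , ∈-++ʳ⁺ (⊥ {M}) (⊤ {M}) ∈⊤)
    crossing (ln-pt x a) = inj₂ (∈-++ʳ⁺ (⊥ {M}) (⊤ {M}) ∈⊤ , ∈-++ˡ⁺ (⊤ {M}) (⊥ {M}) ∈⊤)

  private
    -- Two edges from a point make one side of a polygon of points, in the form that `no-pentagon`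
    -- takes.
    hop : ∀ {x j k} → pt x ~ j → j ~ k →
          ∃[ y ] ∃[ a ] k ≡ pt y × j ≡ ln (line x a) × line x a ≡ line y a
    hop {x} {j} {k} x~j j~k = from-pt refl (~⇒edge x~j) (~⇒edge j~k)
      where
      from-ln : ∀ {a l} → l ≡ ln (line x a) → Edge l k →
                ∃[ y ] ∃[ a ] k ≡ pt y × ln (line x a) ≡ l × line x a ≡ line y a
      from-ln eq (pt-ln _ _) = contradiction eq pt≢ln
      from-ln {a} eq (ln-pt y b) with line-dir (ln-injective eq)
      ... | refl = y , a , refl , sym eq , sym (ln-injective eq)

      from-pt : ∀ {i} → i ≡ pt x → Edge i j → Edge j k →
                ∃[ y ] ∃[ a ] k ≡ pt y × j ≡ ln (line x a) × line x a ≡ line y a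
      from-pt eq (ln-pt _ _) _ = contradiction (sym eq) pt≢ln
      from-pt eq (pt-ln x′ a) j~k with pt-injective eq
      ... | refl = let y , a , p , q , r = from-ln refl j~k in y , a , p , sym q , r

    -- Vertices at even distance from the start are points and the others lines, so five hops turn
    -- the decagon into a pentagon.
    no-decagon-at-point : ∀ {x₁ u₁ u₂ u₃ u₄ u₅ u₆ u₇ u₈ u₉} →
      pt x₁ ~ u₁ → u₁ ~ u₂ → u₂ ~ u₃ → u₃ ~ u₄ → u₄ ~ u₅ →
      u₅ ~ u₆ → u₆ ~ u₇ → u₇ ~ u₈ → u₈ ~ u₉ → u₉ ~ pt x₁ →
      pt x₁ ≢ u₂ → u₂ ≢ u₄ → u₄ ≢ u₆ → u₆ ≢ u₈ → u₈ ≢ pt x₁ →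
      u₁ ≢ u₃ → u₃ ≢ u₅ → u₅ ≢ u₇ → u₇ ≢ u₉ → ¬ u₉ ≢ u₁
    no-decagon-at-point {x₁} e₀ e₁ e₂ e₃ e₄ e₅ e₆ e₇ e₈ e₉ f₁ f₂ f₃ f₄ f₅ g₁ g₂ g₃ g₄ g₅
      with hop e₀ e₁
    ... | x₂ , a₁ , refl , refl , m₁ with hop e₂ e₃
    ... | x₃ , a₂ , refl , refl , m₂ with hop e₄ e₅
    ... | x₄ , a₃ , refl , refl , m₃ with hop e₆ e₇
    ... | x₅ , a₄ , refl , refl , m₄ with hop e₈ e₉
    ... | y , a₅ , x₁≡y , refl , m₅ with pt-injective x₁≡y
    ... | refl = no-pentagon x₁ x₂ x₃ x₄ x₅ a₁ a₂ a₃ a₄ a₅ m₁ m₂ m₃ m₄ m₅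
      (f₁ ∘ cong pt) (f₂ ∘ cong pt) (f₃ ∘ cong pt) (f₄ ∘ cong pt) (f₅ ∘ cong pt)
      (turn m₁ g₁) (turn m₂ g₂) (turn m₃ g₃) (turn m₄ g₄) (turn m₅ g₅)
      where
      -- Both lines pass through y, where the direction determines the line.
      turn : ∀ {x y a b} → line x a ≡ line y a → ln (line x a) ≢ ln (line y b) → a ≢ b
      turn m g refl = g (cong ln m)

  -- Points and lines alternate along the cycle. If vertex 0 is a line, vertex 1 is a point and the
  -- cycle is read from there.
  C₁₀-free : C 10 -Free W
  C₁₀-free W⊇C with Contains⇒decagon {G = W} W⊇C
  ... | f , f-inj , f-~ = from (vertexᵂ (f 0F)) refl
    where
    f≢ : ∀ i j → i ≢ j → f i ≢ f j
    f≢ i j i≢j = i≢j ∘ f-inj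

    from : ∀ {i} → Vertexᵂ i → f 0F ≢ i
    from (isPt x) eq = no-decagon-at-point {x}
      (subst (_~ f 1F) eq (f-~ 0F 1F refl)) (f-~ 1F 2F refl) (f-~ 2F 3F refl)
      (f-~ 3F 4F refl) (f-~ 4F 5F refl) (f-~ 5F 6F refl) (f-~ 6F 7F refl) (f-~ 7F 8F refl)
      (f-~ 8F 9F refl) (subst (f 9F ~_) eq (f-~ 9F 0F refl))
      (subst (_≢ f 2F) eq (f≢ 0F 2F λ ())) (f≢ 2F 4F λ ()) (f≢ 4F 6F λ ()) (f≢ 6F 8F λ ())
      (subst (f 8F ≢_) eq (f≢ 8F 0F λ ()))
      (f≢ 1F 3F λ ()) (f≢ 3F 5F λ ()) (f≢ 5F 7F λ ()) (f≢ 7F 9F λ ()) (f≢ 9F 1F λ ())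
    from (isLn y) eq = next (vertexᵂ (f 1F)) refl
      where
      next : ∀ {j} → Vertexᵂ j → f 1F ≢ j
      next (isLn y′) eq′ = ln≁ln (~⇒edge (subst₂ _~_ eq eq′ (f-~ 0F 1F refl))) refl refl
        where
        ln≁ln : ∀ {i j} → Edge i j → i ≡ ln y → j ≢ ln y′
        ln≁ln (pt-ln _ _) p _ = pt≢ln p
        ln≁ln (ln-pt _ _) _ q = pt≢ln q
      next (isPt x) eq′ = no-decagon-at-point {x}
        (subst (_~ f 2F) eq′ (f-~ 1F 2F refl)) (f-~ 2F 3F refl) (f-~ 3F 4F refl)
        (f-~ 4F 5F refl) (f-~ 5F 6F refl) (f-~ 6F 7F refl) (f-~ 7F 8F refl) (f-~ 8F 9F refl)
        (f-~ 9F 0F refl) (subst (f 0F ~_) eq′ (f-~ 0F 1F refl))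
        (subst (_≢ f 3F) eq′ (f≢ 1F 3F λ ())) (f≢ 3F 5F λ ()) (f≢ 5F 7F λ ()) (f≢ 7F 9F λ ())
        (subst (f 9F ≢_) eq′ (f≢ 9F 1F λ ()))
        (f≢ 2F 4F λ ()) (f≢ 4F 6F λ ()) (f≢ 6F 8F λ ()) (f≢ 8F 0F λ ()) (f≢ 0F 2F λ ())

  -- A point and a line through it, the line being given by its direction; these parametrise the
  -- edges of `W`.
  Flag : Set
  Flag = Fin M × Fin q

  private
    edge : Flag → Fin (M + M) × Fin (M + M)
    edge (x , a) = pt x , ln (line x a)

    edge-injective : ∀ {e e′} → edge e ≡ edge e′ → e ≡ e′
    edge-injective {x , a} {x′ , a′} eq = cong₂ _,_ (pt-injective (cong proj₁ eq))
      (line-dir (ln-injective (cong proj₂ eq)))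

    -- The predicate by which ∣E_∣ filters.
    increasing? : ∀ {n} (G : Graph n) (let open Graph G using () renaming (_~_ to _≈_)) →
                  Decidable (λ ((i , j) : Fin n × Fin n) → i Fin.< j × i ≈ j)
    increasing? G (i , j) = (i Fin.<? j) ×-dec Graph._~?_ G i j

    flags : List Flag
    flags = cartesianProduct (allFin M) (allFin q)

    ∈flags : ∀ e → e ∈ flags
    ∈flags (x , a) = ∈-cartesianProduct⁺ (∈-allFin x) (∈-allFin a)

    flags-unique : Unique flags
    flags-unique = Unique.cartesianProduct⁺ (Unique.allFin⁺ M) (Unique.allFin⁺ q)

  module Subgraph (H : Graph (M + M)) (H⊆W : H ⊆ W) where
    private
      module H = Graph H

    IsFlag : Flag → Set
    IsFlag (x , a) = pt x H.~ ln (line x a)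

    isFlag? : Decidable IsFlag
    isFlag? (x , a) = pt x H.~? ln (line x a)

    flagsᴴ : List Flag
    flagsᴴ = filter isFlag? flags

    flagsᴴ-unique : Unique flagsᴴ
    flagsᴴ-unique = Unique.filter⁺ isFlag? flags-unique

    ∈flagsᴴ⁻ : ∀ {e} → e ∈ flagsᴴ → IsFlag e
    ∈flagsᴴ⁻ e∈ = proj₂ (∈-filter⁻ isFlag? {xs = flags} e∈)

    private
      pairs : List (Fin (M + M) × Fin (M + M))
      pairs = cartesianProduct (allFin (M + M)) (allFin (M + M))

      edgesᴴ : List (Fin (M + M) × Fin (M + M))
      edgesᴴ = filter (increasing? H) pairs

      edgesᴴ⊆ : edgesᴴ ⊆ᴸ map edge flagsᴴ
      edgesᴴ⊆ {i , j} ij∈ =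
        let _ , i<j , i~j = ∈-filter⁻ (increasing? H) {xs = pairs} ij∈
        in from (~⇒edge (proj₂ H⊆W i~j)) i<j i~j
        where
        from : ∀ {i j} → Edge i j → i Fin.< j → i H.~ j → (i , j) ∈ map edge flagsᴴ
        from (pt-ln x a) _   x~l = ∈-map⁺ edge (∈-filter⁺ isFlag? (∈flags (x , a)) x~l)
        from (ln-pt x a) l<x _   = contradiction l<x (ℕ.<⇒≯ (pt<ln x (line x a)))

      ⊆edgesᴴ : map edge flagsᴴ ⊆ᴸ edgesᴴ
      ⊆edgesᴴ e∈ with ∈-map⁻ edge e∈
      ... | (x , a) , xa∈ , refl = ∈-filter⁺ (increasing? H)
        (∈-cartesianProduct⁺ (∈-allFin (pt x)) (∈-allFin (ln (line x a))))
        (pt<ln x (line x a) , ∈flagsᴴ⁻ xa∈)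

    -- Points precede lines in the numbering, so an edge with increasing endpoints is a point
    -- followed by a line, which is one flag.
    ∣E∣≡∣flags∣ : ∣E H ∣ ≡ length flagsᴴ
    ∣E∣≡∣flags∣ = trans (ℕ.≤-antisym
      (unique-⊆⇒length-≤ (Unique.filter⁺ (increasing? H)
        (Unique.cartesianProduct⁺ (Unique.allFin⁺ (M + M)) (Unique.allFin⁺ (M + M)))) edgesᴴ⊆)
      (unique-⊆⇒length-≤ (Unique.map⁺ edge-injective flagsᴴ-unique) ⊆edgesᴴ))
      (List.length-map edge flagsᴴ)

  ∣E∣≡Mq : ∣E W ∣ ≡ M * q
  ∣E∣≡Mq = begin
    ∣E W ∣          ≡⟨ ∣E∣≡∣flags∣ ⟩
    length flagsᴴ   ≡⟨ cong length (List.filter-all isFlag? {xs = flags}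
                         (All.universal (λ (x , a) → pt~ln x a) flags)) ⟩
    length flags    ≡⟨ length-cartesianProduct (allFin M) (allFin q) ⟩
    length (allFin M) * length (allFin q)
                    ≡⟨ cong₂ _*_ (List.length-tabulate {n = M} (λ x → x))
                                    (List.length-tabulate {n = q} (λ x → x)) ⟩
    M * q           ∎
    where
    open ≡-Reasoning
    -- The graph is viewed as a subgraph of itself, in which all flags occur.
    open Subgraph W ((λ i∈ → i∈) , λ i~j → i~j)

  -- Parallelograms in dense subgraphs

  module Parallelogram (H : Graph (M + M)) (H⊆W : H ⊆ W) where
    open Subgraph H H⊆W

    private
      AngleData SegmentData : Set
      AngleData   = Flag × Flag
      SegmentData = AngleData × AngleData

      _≟₁_ : DecidableEquality Flag
      _≟₁_ = Product.≡-dec Fin._≟_ Fin._≟_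

      _≟₂_ : DecidableEquality AngleData
      _≟₂_ = Product.≡-dec _≟₁_ _≟₁_

      _≟₃_ : DecidableEquality SegmentData
      _≟₃_ = Product.≡-dec _≟₂_ _≟₂_

      -- Angles at x and y with the same value have x and y on a common line of direction a, and
      -- both have a flag in direction b.
      carrier : AngleData → Fin (M * q)
      carrier ((x , a) , (_ , b)) = combine (line x a) b

      -- Segments with the same value are translates of each other along direction b.
      translation : SegmentData → Fin (M * q * q)
      translation (((x , a) , (_ , b)) , ((y , _) , _)) =
        combine (combine (line x b) a) (shift x y)

    module Angles   = Collisions _≟₁_ {M} proj₁
    module Segments = Collisions _≟₂_ carrier
    module Squares  = Collisions _≟₃_ translation

    angles : List AngleData
    angles = Angles.collisions flagsᴴ

    segments : List SegmentData
    segments = Segments.collisions angles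

    squares : List (SegmentData × SegmentData)
    squares = Squares.collisions segments

    data Angle : AngleData → Set where
      angle : ∀ {x a b} → a ≢ b → IsFlag (x , a) → IsFlag (x , b) → Angle ((x , a) , (x , b))

    ∈angles⁻ : ∀ {t} → t ∈ angles → Angle t
    ∈angles⁻ t∈ with Angles.∈-collisions⁻ t∈
    ... | xa∈ , xb∈ , refl , xa≢xb = angle (λ { refl → xa≢xb refl }) (∈flagsᴴ⁻ xa∈) (∈flagsᴴ⁻ xb∈)

    data Segment : SegmentData → Set where
      segment : ∀ {x y a b} → x ≢ y → a ≢ b → line x a ≡ line y a →
                IsFlag (x , a) → IsFlag (x , b) → IsFlag (y , a) → IsFlag (y , b) →
                Segment (((x , a) , (x , b)) , ((y , a) , (y , b)))

    ∈segments⁻ : ∀ {t} → t ∈ segments → Segment t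
    ∈segments⁻ {s , t} st∈ with Segments.∈-collisions⁻ st∈
    ... | s∈ , t∈ , eq , s≢t = from (∈angles⁻ s∈) (∈angles⁻ t∈) eq s≢t
      where
      from : ∀ {s t} → Angle s → Angle t → carrier t ≡ carrier s → s ≢ t → Segment (s , t)
      from (angle {x} {a} {b} a≢b xa xb) (angle {y} {c} {d} _ ya yb) eq s≢t
        with Fin.combine-injective (line y c) d (line x a) b eq
      ... | meet , refl with line-dir meet
      ... | refl = segment (λ { refl → s≢t refl }) a≢b (sym meet) xa xb ya yb

    -- The octagon runs through the corners x, x′, y′, y and the sides between them, of directions
    -- a, b, a, b. What remains is to rule out degenerate parallelograms.
    square⇒C₈ : ∀ {s t} → Segment s → Segment t → translation t ≡ translation s → s ≢ t →
                H Contains C 8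
    square⇒C₈ (segment {x} {x′} {a} {b} x≢x′ a≢b xx′ xa xb x′a x′b)
              (segment {y} {y′} {c} {d} y≢y′ _ yy′ ya yb y′a y′b) eq s≢t
      with Fin.combine-injective (combine (line y d) c) (shift y y′)
             (combine (line x b) a) (shift x x′) eq
    ... | eq′ , shift≡ with Fin.combine-injective (line y d) c (line x b) a eq′
    ... | yx , refl with line-dir yx
    ... | refl = octagon⇒Contains H {pt x} {ln (line x a)} {pt x′} {ln (line x′ b)}
                   {pt y′} {ln (line y′ a)} {pt y} {ln (line y b)}
        ( (pt≢ln ∷ pt≢ x≢x′ ∷ pt≢ln ∷ pt≢ x≢y′ ∷ pt≢ln ∷ pt≢ x≢y ∷ pt≢ln ∷ [])
        ∷ (ln≢pt ∷ a∦b ∷ ln≢pt ∷ ln≢ xa≢y′a ∷ ln≢pt ∷ a∦b ∷ [])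
        ∷ (pt≢ln ∷ pt≢ x′≢y′ ∷ pt≢ln ∷ pt≢ x′≢y ∷ pt≢ln ∷ [])
        ∷ (ln≢pt ∷ b∦a ∷ ln≢pt ∷ ln≢ x′b≢yb ∷ [])
        ∷ (pt≢ln ∷ pt≢ (y≢y′ ∘ sym) ∷ pt≢ln ∷ [])
        ∷ (ln≢pt ∷ a∦b ∷ [])
        ∷ (pt≢ln ∷ [])
        ∷ [] ∷ [])
        xa (~symᴴ (on x′ xx′ x′a)) x′b (~symᴴ (on y′ x′y′ y′b)) y′a (~symᴴ (on y (sym yy′) ya))
        yb (~symᴴ (on x yx xb))
      where
      open Graph H using () renaming (_~_ to _~ᴴ_; ~-sym to ~symᴴ)

      on : ∀ z {w e} → line w e ≡ line z e → IsFlag (z , e) → pt z ~ᴴ ln (line w e)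
      on z eq h = subst (λ l → pt z ~ᴴ ln l) (sym eq) h

      x′y′ : line x′ b ≡ line y′ b
      x′y′ = parallelogram a b xx′ yy′ (sym shift≡) (sym yx)

      -- If x = y, equal shifts along the same line give x′ = y′, and the two segments are the same.
      x≢y : x ≢ y
      x≢y refl with shift-injective {x} a xx′ yy′ (sym shift≡)
      ... | refl = s≢t refl

      -- This and the next three coincidences would put x and y on a common line of direction a,
      -- besides the one of direction b.
      x≢y′ : x ≢ y′
      x≢y′ refl = x≢y (two-lines a b a≢b (sym yy′) (sym yx))

      x′≢y : x′ ≢ y
      x′≢y refl = x≢y (two-lines a b a≢b xx′ (sym yx))

      x′≢y′ : x′ ≢ y′
      x′≢y′ refl = x≢y (two-lines a b a≢b (trans xx′ (sym yy′)) (sym yx))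

      xa≢y′a : line x a ≢ line y′ a
      xa≢y′a eq = x≢y (two-lines a b a≢b (trans eq (sym yy′)) (sym yx))

      -- Here x and x′ would share a line of direction b, besides the one of direction a.
      x′b≢yb : line x′ b ≢ line y b
      x′b≢yb eq = x≢x′ (two-lines a b a≢b xx′ (trans (sym yx) (sym eq)))

      pt≢ : ∀ {z w} → z ≢ w → pt z ≢ pt w
      pt≢ z≢w = z≢w ∘ pt-injective

      ln≢ : ∀ {l m} → l ≢ m → ln l ≢ ln m
      ln≢ l≢m = l≢m ∘ ln-injective

      ln≢pt : ∀ {z l} → ln l ≢ pt z
      ln≢pt = pt≢ln ∘ sym

      a∦b : ∀ {z w} → ln (line z a) ≢ ln (line w b)
      a∦b = a≢b ∘ line-dir ∘ ln-injective

      b∦a : ∀ {z w} → ln (line z b) ≢ ln (line w a)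
      b∦a = a∦b ∘ sym

    -- Each count feeds the next: at least (m + 1) M flags, hence m (m + 1) M ≥ (n + 1) M q angles,
    -- hence n (n + 1) M q ≥ 2 M q² segments, twice the number of values of `translation`.
    dense⇒C₈ : ∀ m n → suc m * M ≤ ∣E H ∣ → suc n * q ≤ m * suc m →
               2 * q ≤ n * suc n → 0 < M → 0 < q → H Contains C 8
    dense⇒C₈ m n many-edges nq≤ q≤ 0<M 0<q = find squares 0<squares (λ t∈ → t∈)
      where
      open ℕ.≤-Reasoning

      ∣flags∣≥ : suc m * M ≤ length flagsᴴ
      ∣flags∣≥ = subst (suc m * M ≤_) ∣E∣≡∣flags∣ many-edges

      ∣angles∣≥ : suc n * (M * q) ≤ length angles
      ∣angles∣≥ = begin
        suc n * (M * q)    ≡⟨ solve 3 (λ n M q → n :* (M :* q) := n :* q :* M) refl (suc n) M q ⟩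
        suc n * q * M      ≤⟨ ℕ.*-monoˡ-≤ M nq≤ ⟩
        m * suc m * M      ≡⟨ ℕ.*-assoc m (suc m) M ⟩
        m * (suc m * M)    ≤⟨ ℕ.*-monoʳ-≤ m ∣flags∣≥ ⟩
        m * length flagsᴴ  ≤⟨ Angles.∣collisions∣-≥ m flagsᴴ-unique ∣flags∣≥ ⟩
        length angles      ∎
        where open +-*-Solver

      angles-unique : Unique angles
      angles-unique = Angles.collisions-unique flagsᴴ-unique

      ∣segments∣≥ : 2 * (M * q * q) ≤ length segments
      ∣segments∣≥ = begin
        2 * (M * q * q)          ≡⟨ solve 2 (λ M q → con 2 :* (M :* q :* q) :=
                                      con 2 :* q :* (M :* q)) refl M q ⟩
        2 * q * (M * q)          ≤⟨ ℕ.*-monoˡ-≤ (M * q) q≤ ⟩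
        n * suc n * (M * q)      ≡⟨ ℕ.*-assoc n (suc n) (M * q) ⟩
        n * (suc n * (M * q))    ≤⟨ ℕ.*-monoʳ-≤ n ∣angles∣≥ ⟩
        n * length angles        ≤⟨ Segments.∣collisions∣-≥ n angles-unique ∣angles∣≥ ⟩
        length segments          ∎
        where open +-*-Solver

      0<squares : 0 < length squares
      0<squares = begin-strict
        0                    <⟨ ℕ.*-mono-< {0} {2} z<s (ℕ.*-mono-< (ℕ.*-mono-< 0<M 0<q) 0<q) ⟩
        2 * (M * q * q)      ≤⟨ ∣segments∣≥ ⟩
        length segments      ≡⟨ ℕ.*-identityˡ (length segments) ⟨
        -- The average of two segments per value leaves one collision per segment.
        1 * length segments  ≤⟨ Squares.∣collisions∣-≥ 1
                                  (Segments.collisions-unique angles-unique) ∣segments∣≥ ⟩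
        length squares       ∎

      find : ∀ l → 0 < length l → l ⊆ᴸ squares → H Contains C 8
      find ((s , t) ∷ _) _ l⊆ =
        let s∈ , t∈ , eq , s≢t = Squares.∈-collisions⁻ (l⊆ (here refl))
        in square⇒C₈ (∈segments⁻ s∈) (∈segments⁻ t∈) eq s≢t

-- The choice of the parameters

-- Euclid's argument: a prime factor of n! + 1 that is less than n would divide n!, and hence 1.
prime-above : ∀ n → ∃[ p ] n ≤ p × Prime p
prime-above n = from factors isFactorisation factorsPrime
  where
  open PrimeFactorisation (factorise (suc (n !)))

  from : ∀ ps → suc (n !) ≡ product ps → All Prime ps → ∃[ p ] n ≤ p × Prime p
  from []       eq _ =
    contradiction (ℕ.suc-injective eq) (ℕ.≢-nonZero⁻¹ (n !) {{n ℕ.!≢0}})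
  from (p ∷ ps) eq (p-prime ∷ _) = p , n≤p , p-prime
    where
    p∣p! : ∀ p → Prime p → p ℕ.∣ p !
    p∣p! zero    pr = contradiction pr ¬prime[0]
    p∣p! (suc p) _  = ℕ.m∣m*n (p !)

    p∤1 : ¬ p ℕ.∣ 1
    p∤1 p∣1 = ¬prime[1] (subst Prime (ℕ.∣1⇒≡1 p∣1) p-prime)

    n≤p : n ≤ p
    n≤p = ℕ.≮⇒≥ λ p<n → p∤1 (ℕ.∣m+n∣m⇒∣n
      (subst (p ℕ.∣_) (trans (sym eq) (ℕ.+-comm 1 (n !))) (ℕ.m∣m*n (product ps)))
      (ℕ.∣-trans (p∣p! p p-prime) (ℕ.m≤n⇒m!∣n! (ℕ.<⇒≤ p<n))))

module _ where
  open import Data.Integer.Base using (+_)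

  -- Positivity bounds the sequence of `c` eventually below by some (a + 1) / (k + 1), hence by 1 /
  -- (k + 1). The inequality of reals is used with tolerance 1, whence `suc h`.
  positive-lower-bound : ∀ c → fromℕ 0 <ᴿ c →
    ∃[ k ] ∀ e h → c *ᴿ fromℕ e ≤ᴿ fromℕ h → e ≤ suc k * suc h
  positive-lower-bound c (ℚ.mkℚ (+ 0) _ _ , ℚ.*<* (ℤ.+<+ ()) , _)
  positive-lower-bound c (ℚ.mkℚ -[1+ _ ] _ _ , ℚ.*<* () , _)
  positive-lower-bound c (ε@(ℚ.mkℚ +[1+ a ] k _) , _ , K , ε≤c) = k , λ e h ce≤h →
    let K′ , ce≤h+1 = ce≤h ℚ.1ℚ (ℚ.positive⁻¹ ℚ.1ℚ)
        n = K ⊔ K′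
    in clear e h (ℚ.≤-trans
         (ℚ.*-monoʳ-≤-nonNeg (+ e ℚ./ 1) {{ℚ.normalize-nonNeg e 1}}
           (subst (ℚ._≤ seq c n) (ℚ.+-identityˡ ε) (ε≤c n (ℕ.m≤m⊔n K K′))))
         (ce≤h+1 n (ℕ.m≤n⊔m K K′)))
    where
    toℚᵘ-ℕ : ∀ m → ℚ.toℚᵘ (+ m ℚ./ 1) ℚᵘ.≃ ℚᵘ.mkℚᵘ (+ m) 0
    toℚᵘ-ℕ m = ℚ.toℚᵘ-fromℚᵘ (ℚᵘ.mkℚᵘ (+ m) 0)

    clear : ∀ e h → ε ℚ.* (+ e ℚ./ 1) ℚ.≤ (+ h ℚ./ 1) ℚ.+ ℚ.1ℚ → e ≤ suc k * suc h
    clear e h εe≤h+1 = begin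
      e                           ≤⟨ ℕ.m≤m*n e (suc a) ⟩
      e * suc a                   ≡⟨ ℕ.*-comm e (suc a) ⟩
      suc a * e                   ≤⟨ ℤ.drop‿+≤+ (subst₂ ℤ._≤_ lhs rhs (ℚᵘ.drop-*≤* εe≤h+1ᵘ)) ⟩
      suc k * suc h               ∎
      where
      open ℕ.≤-Reasoning
      εe≤h+1ᵘ : ℚᵘ.mkℚᵘ +[1+ a ] k ℚᵘ.* ℚᵘ.mkℚᵘ (+ e) 0 ℚᵘ.≤ ℚᵘ.mkℚᵘ (+ h) 0 ℚᵘ.+ ℚᵘ.1ℚᵘ
      εe≤h+1ᵘ = ℚᵘ.≤-respˡ-≃
        (ℚᵘ.≃-trans (ℚ.toℚᵘ-homo-* ε (+ e ℚ./ 1)) (ℚᵘ.*-congˡ {ℚ.toℚᵘ ε} (toℚᵘ-ℕ e)))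
        (ℚᵘ.≤-respʳ-≃
          (ℚᵘ.≃-trans (ℚ.toℚᵘ-homo-+ (+ h ℚ./ 1) ℚ.1ℚ) (ℚᵘ.+-congˡ ℚᵘ.1ℚᵘ (toℚᵘ-ℕ h)))
          (ℚ.toℚᵘ-mono-≤ εe≤h+1))
      lhs : (+[1+ a ] ℤ.* + e) ℤ.* + 1 ≡ + (suc a * e)
      lhs = trans (ℤ.*-identityʳ _) (sym (ℤ.pos-* (suc a) e))
      rhs : (+ h ℤ.* + 1 ℤ.+ + 1 ℤ.* + 1) ℤ.* + (suc k * 1) ≡ + (suc k * suc h)
      rhs = trans
        (cong₂ ℤ._*_ (cong (ℤ._+ + 1) (ℤ.*-identityʳ (+ h))) (cong +_ (ℕ.*-identityʳ (suc k))))
        (trans (sym (ℤ.pos-* (h + 1) (suc k))) (cong +_ (trans (ℕ.*-comm (h + 1) (suc k))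
          (cong (suc k *_) (ℕ.+-comm h 1)))))

-- Here `suc m` is the quotient of x by c. It is positive, so discarding the remainder loses at most
-- a factor of 2.
approximate-quotient : ∀ c x b → .{{NonZero c}} → 0 < b → c * b ≤ x →
                       ∃[ m ] b ≤ suc m × suc m * c ≤ x × x ≤ 2 * suc m * c
approximate-quotient c x b 0<b cb≤x = from (x / c) b≤x/c (m/n*n≤m x c)
  (ℕ.≤-trans (ℕ.≤-reflexive (m≡m%n+[m/n]*n x c)) (ℕ.+-monoˡ-≤ (x / c * c) (ℕ.<⇒≤ (m%n<n x c))))
  where
  b≤x/c : b ≤ x / c
  b≤x/c = subst (_≤ x / c) (trans (cong (_/ c) (ℕ.*-comm c b)) (m*n/n≡m b c)) (/-monoˡ-≤ c cb≤x)

  from : ∀ t → b ≤ t → t * c ≤ x → x ≤ c + t * c →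
         ∃[ m ] b ≤ suc m × suc m * c ≤ x × x ≤ 2 * suc m * c
  from zero    b≤0 _ _ = contradiction b≤0 (ℕ.<⇒≱ 0<b)
  from (suc m) b≤t tc≤x x≤ = m , b≤t , tc≤x , (begin
    x                     ≤⟨ x≤ ⟩
    c + suc m * c         ≤⟨ ℕ.+-monoˡ-≤ (suc m * c) (ℕ.m≤n*m c (suc m)) ⟩
    suc m * c + suc m * c ≡⟨ solve 2 (λ t c → t :* c :+ t :* c := con 2 :* t :* c) refl (suc m) c ⟩
    2 * suc m * c         ∎)
    where open ℕ.≤-Reasoning
          open +-*-Solver

-- The numbers m + 1 and n + 1 are the quotients of q by 2k and of m + 1 by 8k. Both are linear in
-- q, so n (n + 1) eventually exceeds 2q; the divisor 8k gives 4k (n + 1) ≤ m, while q ≤ 4k (m + 1).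
parameters : ∀ k → .{{NonZero k}} → ∃[ Q ] ∀ q → Q ≤ q → ∃[ m ] ∃[ n ]
  (∀ M h → 0 < M → M * q ≤ k * suc h → suc m * M ≤ h) ×
  suc n * q ≤ m * suc m × 2 * q ≤ n * suc n
parameters k = 2 * k * (8 * k * b) , choose
  where
  instance
    2k≢0 = ℕ.m*n≢0 2 k
    8k≢0 = ℕ.m*n≢0 8 k

  -- This forces n ≥ 128 k², to match 2q ≤ 8k (m + 1) ≤ 128 k² (n + 1) in `degree₂`.
  b = suc (128 * (k * k))
  open ℕ.≤-Reasoning
  open +-*-Solver

  choose : ∀ q → 2 * k * (8 * k * b) ≤ q → ∃[ m ] ∃[ n ]
    (∀ M h → 0 < M → M * q ≤ k * suc h → suc m * M ≤ h) ×
    suc n * q ≤ m * suc m × 2 * q ≤ n * suc n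
  choose q Q≤q
    with approximate-quotient (2 * k) q (8 * k * b)
           (ℕ.>-nonZero⁻¹ (8 * k * b) {{ℕ.m*n≢0 (8 * k) b}}) Q≤q
  ... | m , 8kb≤t , t2k≤q , q≤2t2k with approximate-quotient (8 * k) (suc m) b z<s 8kb≤t
  ... | n , b≤s , s8k≤t , t≤2s8k = m , n , edges , degree₁ , degree₂
    where
    t = suc m
    s = suc n

    -- If h < t M, then k (h + 1) ≤ k t M, whereas M q ≥ 2 k t M; the 2 in 2k thus absorbs the 1 in
    -- `suc h`.
    edges : ∀ M h → 0 < M → M * q ≤ k * suc h → t * M ≤ h
    edges M h 0<M Mq≤ = ℕ.≮⇒≥ λ h<tM →
      ℕ.<⇒≱ (ℕ.*-mono-< (ℕ.*-mono-< (ℕ.>-nonZero⁻¹ k) (z<s {m})) 0<M)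
      (ℕ.+-cancelˡ-≤ (k * t * M) _ _ (begin
        k * t * M + k * t * M   ≡⟨ solve 3 (λ k t M → k :* t :* M :+ k :* t :* M :=
                                     M :* (t :* (con 2 :* k))) refl k t M ⟩
        M * (t * (2 * k))       ≤⟨ ℕ.*-monoʳ-≤ M t2k≤q ⟩
        M * q                   ≤⟨ Mq≤ ⟩
        k * suc h               ≤⟨ ℕ.*-monoʳ-≤ k h<tM ⟩
        k * (t * M)             ≡⟨ solve 3 (λ k t M → k :* (t :* M) := k :* t :* M :+ con 0)
                                     refl k t M ⟩
        k * t * M + 0           ∎))

    1≤m : 1 ≤ m
    1≤m = s≤s⁻¹ (begin
      2            ≤⟨ s≤s (s≤s z≤n) ⟩
      8            ≤⟨ ℕ.m≤m*n 8 k ⟩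
      8 * k        ≤⟨ ℕ.m≤n*m (8 * k) s ⟩
      s * (8 * k)  ≤⟨ s8k≤t ⟩
      t            ∎)

    4ks≤m : 4 * k * s ≤ m
    4ks≤m = ℕ.*-cancelˡ-≤ 2 (begin
      2 * (4 * k * s) ≡⟨ solve 2 (λ k s → con 2 :* (con 4 :* k :* s) := s :* (con 8 :* k)) refl k s ⟩
      s * (8 * k)     ≤⟨ s8k≤t ⟩
      1 + m           ≤⟨ ℕ.+-monoˡ-≤ m 1≤m ⟩
      m + m           ≡⟨ solve 1 (λ m → m :+ m := con 2 :* m) refl m ⟩
      2 * m           ∎)

    degree₁ : s * q ≤ m * t
    degree₁ = begin
      s * q                 ≤⟨ ℕ.*-monoʳ-≤ s q≤2t2k ⟩
      s * (2 * t * (2 * k)) ≡⟨ solve 3 (λ s t k → s :* (con 2 :* t :* (con 2 :* k)) :=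
                                 con 4 :* k :* s :* t) refl s t k ⟩
      4 * k * s * t         ≤⟨ ℕ.*-monoˡ-≤ t 4ks≤m ⟩
      m * t                 ∎

    degree₂ : 2 * q ≤ n * s
    degree₂ = begin
      2 * q                        ≤⟨ ℕ.*-monoʳ-≤ 2 q≤2t2k ⟩
      2 * (2 * t * (2 * k))        ≡⟨ solve 2 (λ t k → con 2 :* (con 2 :* t :* (con 2 :* k)) :=
                                        con 8 :* k :* t) refl t k ⟩
      8 * k * t                    ≤⟨ ℕ.*-monoʳ-≤ (8 * k) t≤2s8k ⟩
      8 * k * (2 * s * (8 * k))    ≡⟨ solve 2 (λ k s → con 8 :* k :* (con 2 :* s :* (con 8 :* k)) :=
                                        con 128 :* (k :* k) :* s) refl k s ⟩
      128 * (k * k) * s            ≤⟨ ℕ.*-monoˡ-≤ s (s≤s⁻¹ b≤s) ⟩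
      n * s                        ∎

wenger : ∀ p → Prime p → .{{NonZero p}} → Geometry (p ^ 5) p
wenger p pr = record
  { line            = W.line
  ; dir             = W.dir
  ; dir-line        = W.dir-line
  ; two-lines       = W.two-lines
  ; no-pentagon     = W.no-pentagon
  ; shift           = W.shift
  ; shift-injective = λ {x} {y} {z} → W.shift-injective {x} {y} {z}
  ; parallelogram   = λ {x} {x′} {y} {y′} → W.parallelogram {x} {x′} {y} {y′}
  }
  where module W = Wenger₅ p pr

theorem1p3 : (c : ℝ) → fromℕ 0 <ᴿ c → (N₀ : ℕ) → 0 < N₀ →
    ∃[ N ] N₀ ≤ N ×
    (∃[ n ] Σ[ W ∈ Graph n ]
    BipartiteWithParts W N N
    × ∣E W ∣ ^ 5 ≡ N ^ 6
    × C 10 -Free W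
    × (∀ (H : Graph n) → H ⊆ W → c *ᴿ fromℕ ∣E W ∣ ≤ᴿ fromℕ ∣E H ∣ →
    H Contains C 8))
theorem1p3 c 0<c N₀ _ =
  let k , sparse = positive-lower-bound c 0<c
      Q , choose = parameters (suc k)
      p , Q+N₀≤p , p-prime = prime-above (Q + N₀)
      m , n , edges , degree₁ , degree₂ = choose p (ℕ.m+n≤o⇒m≤o Q Q+N₀≤p)
      instance p≢0 = prime⇒nonZero p-prime
      0<p = ℕ.>-nonZero⁻¹ p
      0<N = ℕ.m^n>0 p 5
      open IncidenceGraph (wenger p p-prime)
  in p ^ 5
   , ℕ.≤-trans (ℕ.m+n≤o⇒n≤o Q Q+N₀≤p) (ℕ.m≤m*n p (p ^ 4) {{ℕ.m^n≢0 p 4}})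
   , p ^ 5 + p ^ 5 , W , bipartite
   -- Both sides are p³⁰, as the graph has p⁶ edges and N = p⁵.
   , trans (cong (_^ 5) (trans ∣E∣≡Mq (ℕ.*-comm (p ^ 5) p)))
       (trans (ℕ.^-*-assoc p 6 5) (sym (ℕ.^-*-assoc p 5 6)))
   , C₁₀-free
   , λ H H⊆W dense → Parallelogram.dense⇒C₈ H H⊆W m n
       (edges (p ^ 5) ∣E H ∣ 0<N
         (subst (_≤ suc k * suc ∣E H ∣) ∣E∣≡Mq (sparse ∣E W ∣ ∣E H ∣ dense)))
       degree₁ degree₂ 0<N 0<p
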